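{- Let $d\ge1$ and $k\ge0$ be integers. The map sending a maximal chain $\mathbf{m}=\{\hat0=\pi_0\prec\pi_1\prec\cdots\prec\pi_k=\hat1\}$ of $\mathrm{NC}^{d}_{dk+1}$ to its list of labels $\lambda(\mathbf{m})=(\lambda(\pi_0,\pi_1),\dots,\lambda(\pi_{k-1},\pi_k))$ is a bijection between the set of all maximal chains of $\mathrm{NC}^{d}_{dk+1}$ and the set of all $d$-parking functions of length $k$.
   Context: A partition of $[n]$ is noncrossing if there are no $i<j<k<\ell$ with $i,k$ in one block and $j,\ell$ in a different block. The Kreweras dual $\pi'$ of a noncrossing partition $\pi$ of $[n]$: place $1,1',2,2',\dots,n,n'$ on a circle in this cyclic order; $\pi'$ is the coarsest partition of $\{1',\dots,n'\}$ such that the blocks of $\pi$ and of $\pi'$ together form a noncrossing partition of these $2n$ points. $\mathrm{NC}^d_n$ is the poset, ordered by refinement, of noncrossing partitions $\pi$ of $[n]$ such that every block of $\pi$ and every block of $\pi'$ has cardinality congruent to $1$ modulo $d$. In this poset every cover relation $\pi\prec\sigma$ arises by merging exactly $d+1$ blocks $B_1,\dots,B_{d+1}$ of $\pi$, indexed so that $\min B_1<\min B_2<\cdots<\min B_{d+1}$; the edge label is $\lambda(\pi,\sigma)=\max\{i\in B_1 : i<\min B_2\}$. A $d$-parking function of length $k$ is a list $(a_1,\dots,a_k)$ of positive integers whose nondecreasing rearrangement $a_{(1)}\le\cdots\le a_{(k)}$ satisfies $a_{(i)}\le d(i-1)+1$ for all $i$. -}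

module Defs where

open import Data.Nat using (ℕ; zero; suc; _+_; _*_; _∸_; _≤_; _<_; _<ᵇ_; _≡ᵇ_; _⊔_; NonZero)
open import Data.Nat.DivMod using (_%_)
open import Data.Bool using (Bool; true; false; not; if_then_else_)
open import Data.List using (List; []; _∷_; _++_; map; length; upTo; foldr; _∷ʳ_)
open import Data.Bool.ListAction using (any)
open import Data.List.Membership.Propositional using (_∈_)
open import Data.List.Relation.Unary.All using (All)
open import Data.List.Relation.Unary.Linked using (Linked)
open import Data.List.Relation.Binary.Subset.Propositional using (_⊆_)
open import Data.List.Relation.Binary.Permutation.Propositional using (_↭_)
open import Data.Product using (Σ; ∃; _×_; _,_)
open import Data.Sum using (_⊎_)
open import Data.Unit using (⊤)
open import Data.Empty using (⊥)
open import Relation.Binary.PropositionalEquality using (_≡_; _≢_)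
open import Function.Bundles using (_⇔_)

-- Encoding of set partitions of [n] = {1,…,n}.
-- A partition is a list of blocks, each block a list of naturals.
-- Canonical form: each block is nonempty and strictly increasing,
-- and the blocks are listed in strictly increasing order of their
-- minima.  Every set partition of [n] has exactly one such encoding,
-- so propositional equality of encodings = equality of partitions.

Block : Set
Block = List ℕ

Partition : Set
Partition = List Block

-- first element (minimum, for an increasing block); 0 on [] (never used)
hd : Block → ℕ
hd []      = 0
hd (x ∷ _) = x

NonEmpty : Block → Set
NonEmpty B = B ≢ []

IsPartition : ℕ → Partition → Set
IsPartition n P =
    All (λ B → NonEmpty B × Linked _<_ B) P
  × Linked (λ B C → hd B < hd C) P
  × (∀ i → (1 ≤ i × i ≤ n) ⇔ (∃ λ B → B ∈ P × i ∈ B))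
  × (∀ B C i → B ∈ P → C ∈ P → i ∈ B → i ∈ C → B ≡ C)

NonCrossing : Partition → Set
NonCrossing P =
  ∀ B C → B ∈ P → C ∈ P → B ≢ C →
  ∀ i j k l → i < j → j < k → k < l →
  i ∈ B → k ∈ B → j ∈ C → l ∈ C → ⊥

Refines : Partition → Partition → Set
Refines P Q = ∀ B → B ∈ P → ∃ λ C → C ∈ Q × B ⊆ C

-- Kreweras dual.  The 2n points 1,1',2,2',…,n,n' in cyclic order are
-- identified with 1,2,…,2n via  i ↦ 2i-1  and  i' ↦ 2i.
-- (Noncrossing on a circle = noncrossing for the linear order.)

combine : Partition → Partition → Partition
combine π σ = map (map (λ i → 2 * i ∸ 1)) π ++ map (map (λ i → 2 * i)) σ

IsKrewerasDual : ℕ → Partition → Partition → Set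
IsKrewerasDual n π σ =
    IsPartition n σ
  × NonCrossing (combine π σ)
  × (∀ τ → IsPartition n τ → NonCrossing (combine π τ) → Refines τ σ)

Cong1 : (d : ℕ) → .{{NonZero d}} → ℕ → Set
Cong1 d m = m % d ≡ 1 % d

InNC : (d : ℕ) → .{{NonZero d}} → ℕ → Partition → Set
InNC d n π =
    IsPartition n π
  × NonCrossing π
  × All (λ B → Cong1 d (length B)) π
  × (∃ λ σ → IsKrewerasDual n π σ × All (λ B → Cong1 d (length B)) σ)

Covers : (d : ℕ) → .{{NonZero d}} → ℕ → Partition → Partition → Set
Covers d n π σ =
    InNC d n π × InNC d n σ
  × Refines π σ × π ≢ σ
  × (∀ τ → InNC d n τ → Refines π τ → Refines τ σ → τ ≡ π ⊎ τ ≡ σ)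

bottom : ℕ → Partition
bottom n = map (λ i → suc i ∷ []) (upTo n)

top : ℕ → Partition
top n = map suc (upTo n) ∷ []

-- Edge labels.
-- For a cover π ≺ σ (σ obtained by merging blocks B_1,…,B_{d+1} of π),
-- the merged blocks are exactly the blocks of π that are not blocks of σ;
-- listed in the canonical order of π they are sorted by minima, so
-- B_1, B_2 are the first two of them.  The label is
--   max { i ∈ B_1 : i < min B_2 }.

eqListᵇ : List ℕ → List ℕ → Bool
eqListᵇ []       []       = true
eqListᵇ (x ∷ xs) (y ∷ ys) = if x ≡ᵇ y then eqListᵇ xs ys else false
eqListᵇ _        _        = false

blockOfᵇ : Block → Partition → Bool
blockOfᵇ B P = any (eqListᵇ B) P

merged : Partition → Partition → List Block
merged π σ = Data.List.filterᵇ (λ B → not (blockOfᵇ B σ)) π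
  where import Data.List

maxList : List ℕ → ℕ
maxList = foldr _⊔_ 0

labelFrom : List Block → ℕ
labelFrom (B₁ ∷ B₂ ∷ _) = maxList (Data.List.filterᵇ (λ i → i <ᵇ hd B₂) B₁)
  where import Data.List
labelFrom _             = 0

label : Partition → Partition → ℕ
label π σ = labelFrom (merged π σ)

labels : List Partition → List ℕ
labels (π ∷ σ ∷ rest) = label π σ ∷ labels (σ ∷ rest)
labels _              = []

MaxChain : (d : ℕ) → .{{NonZero d}} → ℕ → List Partition → Set
MaxChain d n m =
    (∃ λ rest → m ≡ bottom n ∷ rest)
  × (∃ λ init → m ≡ init ∷ʳ top n)
  × All (InNC d n) m
  × Linked (Covers d n) m

-- s_(i) ≤ d(i-1)+1, positions counted from i-1 = j
PFBound : ℕ → ℕ → List ℕ → Set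
PFBound d j []       = ⊤
PFBound d j (x ∷ xs) = x ≤ d * j + 1 × PFBound d (suc j) xs

IsParkingFunction : ℕ → ℕ → List ℕ → Set
IsParkingFunction d k a =
    length a ≡ k
  × All (1 ≤_) a
  × (∃ λ s → s ↭ a × Linked _≤_ s × PFBound d 0 s)

-- A noncrossing partition π of [n], n ≡ 1 (mod d), lies in NC^d exactly when every block has size ≡ 1 and
-- consecutive elements of a block differ by ≡ 1 (mod d).  In these terms σ covers π iff one block B of σ is
-- cut as B = P C₁ … C_d Q, with all |C_j| ≡ 1, into the blocks C₁, …, C_d and P Q of π, and the label is
-- the last element of P.
--
-- Given a list of labels, let each x be a vertex with d children for every occurrence of x in the list.
-- Call σ compatible with the list if each block, read from left to right, is the depth-first order of a
-- tree (a Łukasiewicz word).  Then [n] itself is compatible with a list iff the list is a d-parking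
-- function.  Adding a label i turns the trees of C₁, …, C_d into d new first children of i; conversely,
-- removing i detaches these subtrees, and by unique decodability of Łukasiewicz words this determines
-- the cut.  So a chain can be reconstructed from its labels from the top downwards.

module Submission where

open import Defs
open import Data.Nat using (ℕ; zero; suc; _+_; _*_; _∸_; _≤_; _<_; z≤n; s≤s; _<ᵇ_; _≡ᵇ_; NonZero; ≢-nonZero⁻¹)
open import Data.Nat.Properties
open import Data.Nat.DivMod using (_%_; [m+kn]%n≡m%n; m≡m%n+[m/n]*n; _/_)
open import Data.Nat.Divisibility using (divides; ∣⇒≤; ∣m+n∣m⇒∣n; n∣m*n)
open import Data.Nat.Induction using (<-wellFounded)
open import Data.Nat.Tactic.RingSolver using (solve-∀)
open import Induction.WellFounded using (Acc; acc)
open import Data.Bool using (true; false; not; if_then_else_; T)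
open import Data.Bool.Properties using (T?)
open import Data.List using (List; []; _∷_; _++_; map; length; upTo; filter; concat; take; reverse; _ʳ++_; applyUpTo; _∷ʳ_)
open import Data.List.Properties using (∷-injective; ∷-injectiveˡ; ∷-injectiveʳ; ≡-dec; ++-assoc; ++-identityʳ; length-map; length-++; map-∘; length-take; reverse-involutive)
open import Data.List.Sort ≤-decTotalOrder using (sort; sort-↭; sort-↗)
open import Data.List.Membership.Propositional using (_∈_; _∉_; find)
open import Data.List.Membership.Propositional.Properties using (∈-++⁺ˡ; ∈-++⁺ʳ; ∈-++⁻; ∈-map⁺; ∈-map⁻; ∈-filter⁺; ∈-filter⁻; ∈-∃++; ∈-concat⁺′; ∈-concat⁻′)
open import Data.List.Membership.DecPropositional _≟_ using (_∈?_)
open import Data.List.Relation.Unary.All as All using (All; []; _∷_)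
import Data.List.Relation.Unary.All.Properties as Allₚ
open import Data.List.Relation.Unary.Any as Any using (Any; here; there)
import Data.List.Relation.Unary.Any.Properties as Anyₚ
open import Data.List.Relation.Unary.AllPairs as AllPairs using (AllPairs; []; _∷_)
import Data.List.Relation.Unary.AllPairs.Properties as AllPairsₚ
open import Data.List.Relation.Unary.Linked using (Linked; []; [-]; _∷_)
open import Data.List.Relation.Unary.Linked.Properties using (Linked⇒AllPairs; AllPairs⇒Linked)
open import Data.List.Relation.Binary.Subset.Propositional using (_⊆_)
open import Data.List.Relation.Binary.Permutation.Propositional using (_↭_; ↭-sym; prep; swap)
open import Data.List.Relation.Binary.Permutation.Propositional.Properties using (↭-length; ∈-resp-↭; ↭-reverse; All-resp-↭)
open import Data.Product using (∃; _×_; _,_; proj₁; proj₂)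
open import Data.Sum using (_⊎_; inj₁; inj₂)
open import Data.Unit using (tt)
open import Data.Empty using (⊥; ⊥-elim)
open import Function using (_∘_; id; case_of_)
open import Function.Bundles using (mk⇔; Equivalence)
open import Relation.Binary.PropositionalEquality using (_≡_; _≢_; refl; sym; trans; cong; cong₂; subst; module ≡-Reasoning)
open import Relation.Nullary using (¬_; Dec; yes; no; does)
open import Relation.Nullary.Decidable using (map′; _×-dec_; _→-dec_; dec-true; dec-false; decidable-stable)

-- The hard half of the description of covers is that every π strictly below σ lies under some cut
-- of σ. If a block B of σ is not a block of π, some class of the Kreweras dual of π, restricted to
-- B, has two elements. Its size is ≡ 1, so it has at least d + 1, and the first d + 1 of them serve
-- as the last elements of P, C₁, ..., C_d. No block of π separates two points of such a class, so π
-- still refines the partition after the cut. Conversely, a cut raises the number of blocks by d,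
-- and two comparable partitions with equally many blocks coincide, so nothing fits strictly between
-- a cut and σ.
--
-- Being a d-parking function, like compatibility, depends on a list only through the multiplicities
-- of its entries. The order of the labels enters solely through which one is taken away at each
-- level; hence the invariant at a level carries the labels passed below it, and it may hold them in
-- reverse.

Increasing : List ℕ → Set
Increasing = AllPairs _<_

-- Sorted lists are determined by their elements

module _ {A : Set} {R : A → A → Set} (irrefl : ∀ {x} → ¬ R x x) (trans′ : ∀ {x y z} → R x y → R y z → R x z) where

  private
    tail-⊆ : ∀ {x xs ys} → All (R x) xs → (x ∷ xs) ⊆ (x ∷ ys) → xs ⊆ ys
    tail-⊆ x<xs sub z∈xs with sub (there z∈xs)
    ... | here refl = ⊥-elim (irrefl (All.lookup x<xs z∈xs))
    ... | there z∈ys = z∈ys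

  -- Stated for a general strict order because it serves on two levels: blocks are sorted by `_<_`,
  -- and partitions are lists of blocks sorted by their minima.
  sorted-ext : ∀ {xs ys} → AllPairs R xs → AllPairs R ys → xs ⊆ ys → ys ⊆ xs → xs ≡ ys
  sorted-ext [] [] _ _ = refl
  sorted-ext [] (_ ∷ _) _ ys⊆ with () ← ys⊆ (here refl)
  sorted-ext (_ ∷ _) [] xs⊆ _ with () ← xs⊆ (here refl)
  sorted-ext {x ∷ xs} {y ∷ ys} (x< ∷ sx) (y< ∷ sy) xs⊆ ys⊆ with xs⊆ (here refl) | ys⊆ (here refl)
  ... | here refl | _ = cong (x ∷_) (sorted-ext sx sy (tail-⊆ x< xs⊆) (tail-⊆ y< ys⊆))
  ... | there _ | here refl = cong (x ∷_) (sorted-ext sx sy (tail-⊆ x< xs⊆) (tail-⊆ y< ys⊆))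
  ... | there x∈ys | there y∈xs = ⊥-elim (irrefl (trans′ (All.lookup x< y∈xs) (All.lookup y< x∈ys)))

  private
    drop-head : ∀ {x xs y ys} → All (R x) xs → All (R y) ys → x ∈ ys → (x ∷ xs) ⊆ (y ∷ ys) → (x ∷ xs) ⊆ ys
    drop-head x< y< x∈ys sub (here refl) = x∈ys
    drop-head x< y< x∈ys sub (there z∈xs) with sub (there z∈xs)
    ... | there z∈ys = z∈ys
    ... | here refl = ⊥-elim (irrefl (trans′ (All.lookup x< z∈xs) (All.lookup y< x∈ys)))

  sorted-length : ∀ {xs ys} → AllPairs R xs → AllPairs R ys → xs ⊆ ys → length xs ≤ length ys
  sorted-length [] _ _ = z≤n
  sorted-length (_ ∷ _) [] sub with () ← sub (here refl)
  sorted-length {x ∷ xs} {y ∷ ys} (x< ∷ sx) (y< ∷ sy) sub with sub (here refl)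
  ... | here refl = s≤s (sorted-length sx sy (tail-⊆ x< sub))
  ... | there x∈ys = m≤n⇒m≤1+n (sorted-length (x< ∷ sx) sy (drop-head x< y< x∈ys sub))

  sorted-⊆-≡ : ∀ {xs ys} → AllPairs R xs → AllPairs R ys → xs ⊆ ys → length ys ≤ length xs → xs ≡ ys
  sorted-⊆-≡ [] [] _ _ = refl
  sorted-⊆-≡ (_ ∷ _) [] sub _ with () ← sub (here refl)
  sorted-⊆-≡ {x ∷ xs} {y ∷ ys} (x< ∷ sx) (y< ∷ sy) sub len with sub (here refl)
  ... | here refl = cong (x ∷_) (sorted-⊆-≡ sx sy (tail-⊆ x< sub) (≤-pred len))
  ... | there x∈ys = ⊥-elim (<⇒≱ len (sorted-length (x< ∷ sx) sy (drop-head x< y< x∈ys sub)))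

increasing-ext : ∀ {xs ys} → Increasing xs → Increasing ys → xs ⊆ ys → ys ⊆ xs → xs ≡ ys
increasing-ext = sorted-ext (<-irrefl refl) <-trans

AllPairs-map-All : {A : Set} {P : A → Set} {R S : A → A → Set} → (∀ {x y} → P x → P y → R x y → S x y) →
  ∀ {xs} → All P xs → AllPairs R xs → AllPairs S xs
AllPairs-map-All f [] [] = []
AllPairs-map-All f (px ∷ pxs) (rx ∷ rxs) = All.zipWith (λ (py , r) → f px py r) (pxs , rx) ∷ AllPairs-map-All f pxs rxs

module _ {A : Set} {R : A → A → Set} where

  AllPairs-++⁻ˡ : ∀ xs {ys} → AllPairs R (xs ++ ys) → AllPairs R xs
  AllPairs-++⁻ˡ [] _ = []
  AllPairs-++⁻ˡ (x ∷ xs) (r ∷ rs) = Allₚ.++⁻ˡ xs r ∷ AllPairs-++⁻ˡ xs rs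

  AllPairs-++⁻ʳ : ∀ xs {ys} → AllPairs R (xs ++ ys) → AllPairs R ys
  AllPairs-++⁻ʳ [] rs = rs
  AllPairs-++⁻ʳ (x ∷ xs) (r ∷ rs) = AllPairs-++⁻ʳ xs rs

  AllPairs-++-cross : ∀ xs {ys} → AllPairs R (xs ++ ys) → ∀ {x y} → x ∈ xs → y ∈ ys → R x y
  AllPairs-++-cross (x ∷ xs) (r ∷ rs) (here refl) y∈ = All.lookup (Allₚ.++⁻ʳ xs r) y∈
  AllPairs-++-cross (x ∷ xs) (r ∷ rs) (there x∈) y∈ = AllPairs-++-cross xs rs x∈ y∈

  AllPairs-omit : ∀ xs ys {zs} → AllPairs R (xs ++ ys ++ zs) → AllPairs R (xs ++ zs)
  AllPairs-omit xs ys rs =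
    AllPairsₚ.++⁺ (AllPairs-++⁻ˡ xs rs) (AllPairs-++⁻ʳ ys (AllPairs-++⁻ʳ xs rs))
      (All.tabulate λ x∈ → All.tabulate λ z∈ → AllPairs-++-cross xs rs x∈ (∈-++⁺ʳ ys z∈))

-- First, last and neighbouring elements of increasing lists

lst : List ℕ → ℕ
lst [] = 0
lst (x ∷ []) = x
lst (_ ∷ y ∷ r) = lst (y ∷ r)

∈⇒≢[] : ∀ {A : Set} {x : A} {xs} → x ∈ xs → xs ≢ []
∈⇒≢[] () refl

hd-∈ : ∀ {B} → B ≢ [] → hd B ∈ B
hd-∈ {[]} ne = ⊥-elim (ne refl)
hd-∈ {_ ∷ _} _ = here refl

lst-∈ : ∀ {B} → B ≢ [] → lst B ∈ B
lst-∈ {[]} ne = ⊥-elim (ne refl)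
lst-∈ {_ ∷ []} _ = here refl
lst-∈ {_ ∷ y ∷ r} _ = there (lst-∈ {y ∷ r} λ ())

hd-≤ : ∀ {B x} → Increasing B → x ∈ B → hd B ≤ x
hd-≤ (_ ∷ _) (here refl) = ≤-refl
hd-≤ (r ∷ _) (there x∈) = <⇒≤ (All.lookup r x∈)

≤-lst : ∀ {B x} → Increasing B → x ∈ B → x ≤ lst B
≤-lst {_ ∷ []} _ (here refl) = ≤-refl
≤-lst {_ ∷ y ∷ r} ((x<y ∷ _) ∷ inc) (here refl) = ≤-trans (<⇒≤ x<y) (≤-lst inc (here refl))
≤-lst {_ ∷ y ∷ r} (_ ∷ inc) (there x∈) = ≤-lst inc x∈

lst-++ : ∀ P {C} → C ≢ [] → lst (P ++ C) ≡ lst C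
lst-++ [] _ = refl
lst-++ (_ ∷ []) {[]} ne = ⊥-elim (ne refl)
lst-++ (_ ∷ []) {_ ∷ _} _ = refl
lst-++ (_ ∷ y ∷ P) ne = lst-++ (y ∷ P) ne

lst-∷ʳ : ∀ P x → lst (P ∷ʳ x) ≡ x
lst-∷ʳ P x = lst-++ P λ ()

hd-++ : ∀ P {Q} → P ≢ [] → hd (P ++ Q) ≡ hd P
hd-++ [] ne = ⊥-elim (ne refl)
hd-++ (_ ∷ _) _ = refl

-- Adjacency is expressed by membership and order alone, so that it can be verified for filtered
-- lists such as faces without following positions.
record Consec (L : List ℕ) (p h : ℕ) : Set where
  constructor consec
  field
    left  : p ∈ L
    right : h ∈ L
    less  : p < h
    gap   : ∀ {y} → y ∈ L → y ≤ p ⊎ h ≤ y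

Consec-there : ∀ {x L p h} → All (x <_) L → Consec L p h → Consec (x ∷ L) p h
Consec-there x< (consec p∈ h∈ p<h gap) = consec (there p∈) (there h∈) p<h λ where
  (here refl) → inj₁ (<⇒≤ (All.lookup x< p∈))
  (there y∈) → gap y∈

Consec-here : ∀ {x y L} → Increasing (x ∷ y ∷ L) → Consec (x ∷ y ∷ L) x y
Consec-here ((x<y ∷ _) ∷ inc) = consec (here refl) (there (here refl)) x<y λ where
  (here refl) → inj₁ ≤-refl
  (there z∈) → inj₂ (hd-≤ inc z∈)

next : ∀ {L x} → Increasing L → x ∈ L → x ≡ lst L ⊎ ∃ (Consec L x)
next {_ ∷ []} _ (here refl) = inj₁ refl
next {_ ∷ _ ∷ _} inc (here refl) = inj₂ (_ , Consec-here inc)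
next {_ ∷ _ ∷ _} (x< ∷ inc) (there x∈) with next inc x∈
... | inj₁ eq = inj₁ eq
... | inj₂ (h , c) = inj₂ (h , Consec-there x< c)

prev : ∀ {L x} → Increasing L → x ∈ L → x ≡ hd L ⊎ ∃ λ p → Consec L p x
prev _ (here refl) = inj₁ refl
prev {_ ∷ _ ∷ _} inc′@(x< ∷ inc) (there x∈) with prev inc x∈
... | inj₁ refl = inj₂ (_ , Consec-here inc′)
... | inj₂ (p , c) = inj₂ (p , Consec-there x< c)

interval : ℕ → ℕ → List ℕ
interval x zero = []
interval x (suc l) = x ∷ interval (suc x) l

∈-interval⁻ : ∀ x l {y} → y ∈ interval x l → x ≤ y × y < x + l
∈-interval⁻ x (suc l) (here refl) = ≤-refl , m<m+n x (s≤s z≤n)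
∈-interval⁻ x (suc l) {y} (there y∈) with ∈-interval⁻ (suc x) l y∈
... | a , b = <⇒≤ a , subst (y <_) (sym (+-suc x l)) b

∈-interval⁺ : ∀ x l {y} → x ≤ y → y < x + l → y ∈ interval x l
∈-interval⁺ x zero x≤y y< = ⊥-elim (<⇒≱ (subst (_ <_) (+-identityʳ x) y<) x≤y)
∈-interval⁺ x (suc l) {y} x≤y y< with x ≟ y
... | yes refl = here refl
... | no x≢y = there (∈-interval⁺ (suc x) l (≤∧≢⇒< x≤y x≢y) (subst (y <_) (+-suc x l) y<))

interval-increasing : ∀ x l → Increasing (interval x l)
interval-increasing x zero = []
interval-increasing x (suc l) = All.tabulate (λ y∈ → proj₁ (∈-interval⁻ (suc x) l y∈)) ∷ interval-increasing (suc x) l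

length-interval : ∀ x l → length (interval x l) ≡ l
length-interval x zero = refl
length-interval x (suc l) = cong suc (length-interval (suc x) l)

-- Set partitions

_≟ᴮ_ : (B C : Block) → Dec (B ≡ C)
_≟ᴮ_ = ≡-dec _≟_

_≟ᴾ_ : (P Q : Partition) → Dec (P ≡ Q)
_≟ᴾ_ = ≡-dec _≟ᴮ_

open import Data.List.Membership.DecPropositional _≟ᴮ_ using () renaming (_∈?_ to _∈ᴮ?_)

_<ʰ_ : Block → Block → Set
B <ʰ C = hd B < hd C

mkPartition : ∀ {n P} → (∀ {B} → B ∈ P → B ≢ [] × Increasing B) → AllPairs _<ʰ_ P →
  (∀ {B i} → B ∈ P → i ∈ B → 1 ≤ i × i ≤ n) → (∀ {i} → 1 ≤ i → i ≤ n → ∃ λ B → B ∈ P × i ∈ B) →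
  (∀ {B C i} → B ∈ P → C ∈ P → i ∈ B → i ∈ C → B ≡ C) → IsPartition n P
mkPartition blocks heads range cover uniq =
  All.tabulate (λ B∈ → proj₁ (blocks B∈) , AllPairs⇒Linked (proj₂ (blocks B∈))) ,
  AllPairs⇒Linked heads ,
  (λ i → mk⇔ (λ (a , b) → cover a b) (λ (B , B∈ , i∈) → range B∈ i∈)) ,
  (λ B C i B∈ C∈ i∈B i∈C → uniq B∈ C∈ i∈B i∈C)

module PartitionOf {n P} (isP : IsPartition n P) where

  block-≢[] : ∀ {B} → B ∈ P → B ≢ []
  block-≢[] B∈ = proj₁ (All.lookup (proj₁ isP) B∈)

  block-increasing : ∀ {B} → B ∈ P → Increasing B
  block-increasing B∈ = Linked⇒AllPairs <-trans (proj₂ (All.lookup (proj₁ isP) B∈))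

  heads : AllPairs _<ʰ_ P
  heads = Linked⇒AllPairs <-trans (proj₁ (proj₂ isP))

  range : ∀ {B i} → B ∈ P → i ∈ B → 1 ≤ i × i ≤ n
  range {B} {i} B∈ i∈ = Equivalence.from (proj₁ (proj₂ (proj₂ isP)) i) (B , B∈ , i∈)

  cover : ∀ {i} → 1 ≤ i → i ≤ n → ∃ λ B → B ∈ P × i ∈ B
  cover {i} a b = Equivalence.to (proj₁ (proj₂ (proj₂ isP)) i) (a , b)

  uniq : ∀ {B C i} → B ∈ P → C ∈ P → i ∈ B → i ∈ C → B ≡ C
  uniq B∈ C∈ i∈B i∈C = proj₂ (proj₂ (proj₂ isP)) _ _ _ B∈ C∈ i∈B i∈C

open PartitionOf

-- A tie among the four points puts a common element into B and C, and then disjointness of blocks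
-- replaces noncrossing. The weak inequalities spare a case distinction at almost every use.
nonCrossing-≤ : ∀ {n P} → IsPartition n P → NonCrossing P → ∀ {B C i j k l} → B ∈ P → C ∈ P →
  i ≤ j → j ≤ k → k ≤ l → i ∈ B → k ∈ B → j ∈ C → l ∈ C → B ≡ C
nonCrossing-≤ isP nc {B} {C} {i} {j} {k} {l} B∈ C∈ i≤j j≤k k≤l i∈ k∈ j∈ l∈ with i ≟ j | j ≟ k | k ≟ l
... | yes refl | _ | _ = uniq isP B∈ C∈ i∈ j∈
... | no _ | yes refl | _ = uniq isP B∈ C∈ k∈ j∈
... | no _ | no _ | yes refl = uniq isP B∈ C∈ k∈ l∈
... | no a | no b | no c = decidable-stable (B ≟ᴮ C) λ B≢C →
  nc B C B∈ C∈ B≢C i j k l (≤∧≢⇒< i≤j a) (≤∧≢⇒< j≤k b) (≤∧≢⇒< k≤l c) i∈ k∈ j∈ l∈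

mkNonCrossing : ∀ {P} → (∀ {B C i j k l} → B ∈ P → C ∈ P →
  i < j → j < k → k < l → i ∈ B → k ∈ B → j ∈ C → l ∈ C → B ≡ C) → NonCrossing P
mkNonCrossing f B C B∈ C∈ B≢C i j k l a b c i∈ k∈ j∈ l∈ = B≢C (f B∈ C∈ a b c i∈ k∈ j∈ l∈)

refines-⊆ : ∀ {n π σ} → IsPartition n σ → Refines π σ → ∀ {D B x} → D ∈ π → B ∈ σ → x ∈ D → x ∈ B → D ⊆ B
refines-⊆ isσ ref {D} D∈ B∈ x∈D x∈B with ref D D∈
... | E , E∈ , D⊆E with uniq isσ E∈ B∈ (D⊆E x∈D) x∈B
... | refl = D⊆E

refines-trans : ∀ {π ρ σ} → Refines π ρ → Refines ρ σ → Refines π σ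
refines-trans r s B B∈ with r B B∈
... | C , C∈ , B⊆C with s C C∈
... | D , D∈ , C⊆D = D , D∈ , C⊆D ∘ B⊆C

∈-antisym : ∀ {n P Q} → IsPartition n P → IsPartition n Q → P ⊆ Q → Q ⊆ P → P ≡ Q
∈-antisym isP isQ = sorted-ext {R = _<ʰ_} (<-irrefl refl) <-trans (heads isP) (heads isQ)

private
  refines-antisym-∈ : ∀ {n P Q} → IsPartition n P → IsPartition n Q → Refines P Q → Refines Q P → P ⊆ Q
  refines-antisym-∈ isP isQ PQ QP {B} B∈ with PQ B B∈
  ... | C , C∈ , B⊆C with QP C C∈
  ... | B′ , B′∈ , C⊆B′ with uniq isP B∈ B′∈ (hd-∈ (block-≢[] isP B∈)) (C⊆B′ (B⊆C (hd-∈ (block-≢[] isP B∈))))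
  ... | refl with increasing-ext (block-increasing isP B∈) (block-increasing isQ C∈) B⊆C C⊆B′
  ... | refl = C∈

refines-antisym : ∀ {n P Q} → IsPartition n P → IsPartition n Q → Refines P Q → Refines Q P → P ≡ Q
refines-antisym isP isQ PQ QP =
  ∈-antisym isP isQ (refines-antisym-∈ isP isQ PQ QP) (refines-antisym-∈ isQ isP QP PQ)

-- The minima of the blocks of Q are also minima of blocks of P, so equality of the numbers of blocks
-- leaves exactly one block of P in each block of Q.
refines-length-≡ : ∀ {n P Q} → IsPartition n P → IsPartition n Q → Refines P Q → length P ≡ length Q → P ≡ Q
refines-length-≡ {n} {P} {Q} isP isQ PQ len = refines-antisym isP isQ PQ QP
  where
  min-block : ∀ {C} → C ∈ Q → ∃ λ B → B ∈ P × B ⊆ C × hd B ≡ hd C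
  min-block {C} C∈ with range isQ C∈ (hd-∈ (block-≢[] isQ C∈))
  ... | a , b with cover isP a b
  ... | B , B∈ , h∈ with refines-⊆ isQ PQ B∈ C∈ h∈ (hd-∈ (block-≢[] isQ C∈))
  ... | B⊆C = B , B∈ , B⊆C , ≤-antisym (hd-≤ (block-increasing isP B∈) h∈)
        (hd-≤ (block-increasing isQ C∈) (B⊆C (hd-∈ (block-≢[] isP B∈))))
  heads-⊆ : map hd Q ⊆ map hd P
  heads-⊆ z∈ with ∈-map⁻ hd z∈
  ... | C , C∈ , refl with min-block C∈
  ... | B , B∈ , _ , eq = subst (_∈ map hd P) eq (∈-map⁺ hd B∈)
  heads-≡ : map hd Q ≡ map hd P
  heads-≡ = sorted-⊆-≡ {R = _<_} (<-irrefl refl) <-trans (AllPairsₚ.map⁺ {f = hd} (heads isQ)) (AllPairsₚ.map⁺ {f = hd} (heads isP)) heads-⊆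
    (≤-reflexive (trans (length-map hd P)
      (trans len (sym (length-map hd Q)))))
  hd-unique : ∀ {B C} → B ∈ P → C ∈ Q → B ⊆ C → hd B ≡ hd C
  hd-unique {B} {C} B∈ C∈ B⊆C with ∈-map⁻ hd (subst (hd B ∈_) (sym heads-≡) (∈-map⁺ hd B∈))
  ... | C′ , C′∈ , eq with uniq isQ C∈ C′∈ (B⊆C (hd-∈ (block-≢[] isP B∈)))
                             (subst (_∈ C′) (sym eq) (hd-∈ (block-≢[] isQ C′∈)))
  ... | refl = eq
  QP : Refines Q P
  QP C C∈ with min-block C∈
  ... | B , B∈ , B⊆C , hB = B , B∈ , C⊆B
    where
    C⊆B : C ⊆ B
    C⊆B y∈ with range isQ C∈ y∈
    ... | a , b with cover isP a b
    ... | B₂ , B₂∈ , y∈B₂ with hd-unique B₂∈ C∈ (refines-⊆ isQ PQ B₂∈ C∈ y∈B₂ y∈)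
    ... | h₂ with uniq isP B∈ B₂∈ (hd-∈ (block-≢[] isP B∈))
                    (subst (_∈ B₂) (trans h₂ (sym hB)) (hd-∈ (block-≢[] isP B₂∈)))
    ... | refl = y∈B₂

module Classes (n : ℕ) {_≈_ : ℕ → ℕ → Set} (_≈?_ : ∀ x y → Dec (x ≈ y))
  (≈-refl : ∀ {x} → x ≈ x) (≈-sym : ∀ {x y} → x ≈ y → y ≈ x) (≈-trans : ∀ {x y z} → x ≈ y → y ≈ z → x ≈ z) where

  abstract
    class : ℕ → Block
    class x = filter (x ≈?_) (interval 1 n)

    private
      rep? : ∀ x → Dec (hd (class x) ≡ x)
      rep? x = hd (class x) ≟ x

    -- Each class is listed once, at its least element: the representatives kept are those x that
    -- head their own class. Taken in increasing order they put the classes into the canonical order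
    -- by minima.
    classes : Partition
    classes = map class (filter rep? (interval 1 n))

    ∈-class⁻ : ∀ {x y} → y ∈ class x → (1 ≤ y × y ≤ n) × x ≈ y
    ∈-class⁻ {x} y∈ with ∈-filter⁻ (x ≈?_) {xs = interval 1 n} y∈
    ... | y∈i , x≈y with ∈-interval⁻ 1 n y∈i
    ... | a , b = (a , ≤-pred b) , x≈y

    ∈-class⁺ : ∀ {x y} → 1 ≤ y → y ≤ n → x ≈ y → y ∈ class x
    ∈-class⁺ {x} a b x≈y = ∈-filter⁺ (x ≈?_) (∈-interval⁺ 1 n a (s≤s b)) x≈y

    class-increasing : ∀ x → Increasing (class x)
    class-increasing x = AllPairsₚ.filter⁺ (x ≈?_) (interval-increasing 1 n)

    class-cong : ∀ {x y} → x ≈ y → class x ≡ class y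
    class-cong {x} {y} x≈y = increasing-ext (class-increasing x) (class-increasing y) (sub x≈y) (sub (≈-sym x≈y))
      where
      sub : ∀ {x y} → x ≈ y → class x ⊆ class y
      sub x≈y z∈ with ∈-class⁻ z∈
      ... | (a , b) , x≈z = ∈-class⁺ a b (≈-trans (≈-sym x≈y) x≈z)

    class-∈ : ∀ {x} → 1 ≤ x → x ≤ n → class x ∈ classes
    class-∈ {x} a b with ∈-class⁻ (hd-∈ (∈⇒≢[] (∈-class⁺ a b (≈-refl {x}))))
    ... | (c , d) , x≈r = subst (_∈ classes) (sym (class-cong x≈r))
          (∈-map⁺ class (∈-filter⁺ rep? (∈-interval⁺ 1 n c (s≤s d)) (cong hd (sym (class-cong x≈r)))))

    ∈-classes⁻ : ∀ {B} → B ∈ classes → ∃ λ x → (1 ≤ x × x ≤ n) × B ≡ class x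
    ∈-classes⁻ B∈ with ∈-map⁻ class B∈
    ... | x , x∈ , refl with ∈-interval⁻ 1 n (proj₁ (∈-filter⁻ rep? {xs = interval 1 n} x∈))
    ... | a , b = x , (a , ≤-pred b) , refl

    classes-isPartition : IsPartition n classes
    classes-isPartition = mkPartition blocks heads′ range′ cover′ uniq′
      where
      blocks : ∀ {B} → B ∈ classes → B ≢ [] × Increasing B
      blocks B∈ with ∈-classes⁻ B∈
      ... | x , (a , b) , refl = ∈⇒≢[] (∈-class⁺ a b (≈-refl {x})) , class-increasing x
      heads′ : AllPairs _<ʰ_ classes
      heads′ = AllPairsₚ.map⁺ (AllPairs-map-All {P = λ x → hd (class x) ≡ x} {S = λ x y → class x <ʰ class y} (λ p q x<y → subst₂′ (sym p) (sym q) x<y)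
        (Allₚ.all-filter rep? (interval 1 n)) (AllPairsₚ.filter⁺ rep? (interval-increasing 1 n)))
        where
        subst₂′ : ∀ {a b c d} → a ≡ c → b ≡ d → a < b → c < d
        subst₂′ refl refl p = p
      range′ : ∀ {B i} → B ∈ classes → i ∈ B → 1 ≤ i × i ≤ n
      range′ B∈ i∈ with ∈-classes⁻ B∈
      ... | x , _ , refl = proj₁ (∈-class⁻ i∈)
      cover′ : ∀ {i} → 1 ≤ i → i ≤ n → ∃ λ B → B ∈ classes × i ∈ B
      cover′ {i} a b = class i , class-∈ a b , ∈-class⁺ a b ≈-refl
      uniq′ : ∀ {B C i} → B ∈ classes → C ∈ classes → i ∈ B → i ∈ C → B ≡ C
      uniq′ B∈ C∈ i∈B i∈C with ∈-classes⁻ B∈ | ∈-classes⁻ C∈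
      ... | x , _ , refl | y , _ , refl = class-cong (≈-trans (proj₂ (∈-class⁻ i∈B)) (≈-sym (proj₂ (∈-class⁻ i∈C))))

    class-filter : ∀ x → class x ≡ filter (x ≈?_) (interval 1 n)
    class-filter _ = refl

-- The Kreweras dual

-- The points i and i′ sit at positions odd i and even i.
odd even : ℕ → ℕ
odd i = 2 * i ∸ 1
even i = 2 * i

odd<even⇒≤ : ∀ {i j} → odd i < even j → i ≤ j
odd<even⇒≤ {zero} _ = z≤n
odd<even⇒≤ {suc i} {j} p = ≮⇒≥ λ j<si → <⇒≱ p
  (≤-trans (*-monoʳ-≤ 2 (≤-pred j<si)) (+-monoʳ-≤ i (n≤1+n (i + 0))))

even<odd⇒< : ∀ {j k} → even j < odd k → j < k
even<odd⇒< {j} {k} p = ≰⇒> λ k≤j → <⇒≱ p (≤-trans (m∸n≤m (2 * k) 1) (*-monoʳ-≤ 2 k≤j))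

odd<odd⇒< : ∀ {i j} → odd i < odd j → i < j
odd<odd⇒< p = ≰⇒> λ j≤i → <⇒≱ p (∸-monoˡ-≤ 1 (*-monoʳ-≤ 2 j≤i))

even<even⇒< : ∀ {i j} → even i < even j → i < j
even<even⇒< = *-cancelˡ-< 2 _ _

≤⇒odd<even : ∀ {i j} → 1 ≤ i → i ≤ j → odd i < even j
≤⇒odd<even {suc i} _ i≤j = <-≤-trans (n<1+n _) (*-monoʳ-≤ 2 i≤j)

<⇒even<odd : ∀ {j k} → j < k → even j < odd k
<⇒even<odd {j} {suc k} (s≤s j≤k) = ≤-<-trans (*-monoʳ-≤ 2 j≤k) (+-monoʳ-< k (n<1+n (k + 0)))

odd≢even : ∀ {i j} → 1 ≤ i → odd i ≢ even j
odd≢even {i} {j} 1≤i eq with <-≤-connex j i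
... | inj₁ j<i = <-irrefl (sym eq) (<⇒even<odd j<i)
... | inj₂ i≤j = <-irrefl eq (≤⇒odd<even 1≤i i≤j)

-- f ∼ g says that no block of π separates the points f′ and g′: the chord joining two points
-- x < y of [n] separates j′ from n′ exactly when x ≤ j < y.
module Separation (π : Partition) where

  record _⊑_ (f g : ℕ) : Set where
    constructor ⟨_⟩
    field
      apply : ∀ {B x y} → B ∈ π → x ∈ B → y ∈ B → x ≤ f → f < y → x ≤ g × g < y

  open _⊑_ public

  _∼_ : ℕ → ℕ → Set
  f ∼ g = f ⊑ g × g ⊑ f

  ∼-refl : ∀ {f} → f ∼ f
  ∼-refl = ⟨ (λ _ _ _ a b → a , b) ⟩ , ⟨ (λ _ _ _ a b → a , b) ⟩

  ∼-sym : ∀ {f g} → f ∼ g → g ∼ f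
  ∼-sym (p , q) = q , p

  private
    ⊑-trans : ∀ {f g h} → f ⊑ g → g ⊑ h → f ⊑ h
    ⊑-trans p q = ⟨ (λ B∈ x∈ y∈ a b → let (c , d) = apply p B∈ x∈ y∈ a b in apply q B∈ x∈ y∈ c d) ⟩

  ∼-trans : ∀ {f g h} → f ∼ g → g ∼ h → f ∼ h
  ∼-trans (p , p′) (q , q′) = ⊑-trans p q , ⊑-trans q′ p′

  _⊑?_ : ∀ f g → Dec (f ⊑ g)
  f ⊑? g = map′ (λ a → ⟨ (λ B∈ x∈ y∈ p q → All.lookup (All.lookup (All.lookup a B∈) x∈) y∈ (p , q)) ⟩)
    (λ h → All.tabulate λ B∈ → All.tabulate λ x∈ → All.tabulate λ y∈ (p , q) → apply h B∈ x∈ y∈ p q)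
    (All.all? (λ B → All.all? (λ x → All.all? (λ y →
      (x ≤? f ×-dec f <? y) →-dec (x ≤? g ×-dec g <? y)) B) B) π)

  _∼?_ : ∀ f g → Dec (f ∼ g)
  f ∼? g = (f ⊑? g) ×-dec (g ⊑? f)

module Dual {n π} (isπ : IsPartition n π) (ncπ : NonCrossing π) where

  open Separation π
  open Classes n _∼?_ ∼-refl ∼-sym ∼-trans public

  private
    class-∼ : ∀ {C f g} → C ∈ classes → f ∈ C → g ∈ C → f ∼ g
    class-∼ C∈ f∈ g∈ with ∈-classes⁻ C∈
    ... | r , _ , refl = ∼-trans (∼-sym (proj₂ (∈-class⁻ f∈))) (proj₂ (∈-class⁻ g∈))

    classes-∼ : ∀ {C D f g} → C ∈ classes → D ∈ classes → f ∈ C → g ∈ D → f ∼ g → C ≡ D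
    classes-∼ C∈ D∈ f∈ g∈ f∼g with ∈-classes⁻ C∈ | ∈-classes⁻ D∈
    ... | r , _ , refl | s , _ , refl =
      class-cong (∼-trans (proj₂ (∈-class⁻ f∈)) (∼-trans f∼g (∼-sym (proj₂ (∈-class⁻ g∈)))))

    -- A chord over i is also over k, hence over j in between. A chord over j reaches beyond l,
    -- hence is over k, and so over i.
    crossing-∼ : ∀ {i j k l} → i < j → j < k → k < l → i ∼ k → j ∼ l → i ∼ j
    crossing-∼ {i} {j} {k} {l} i<j j<k k<l (i⊑k , k⊑i) (j⊑l , _) = ⟨ i⊑j ⟩ , ⟨ j⊑i ⟩
      where
      i⊑j : ∀ {B x y} → B ∈ π → x ∈ B → y ∈ B → x ≤ i → i < y → x ≤ j × j < y
      i⊑j B∈ x∈ y∈ x≤i i<y = ≤-trans x≤i (<⇒≤ i<j) , <-trans j<k (proj₂ (apply i⊑k B∈ x∈ y∈ x≤i i<y))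
      j⊑i : ∀ {B x y} → B ∈ π → x ∈ B → y ∈ B → x ≤ j → j < y → x ≤ i × i < y
      j⊑i B∈ x∈ y∈ x≤j j<y =
        proj₁ (apply k⊑i B∈ x∈ y∈ (≤-trans x≤j (<⇒≤ j<k)) (<-trans k<l (proj₂ (apply j⊑l B∈ x∈ y∈ x≤j j<y)))) , <-trans i<j j<y

    data Source (D : Block) : Set where
      primal : ∀ B → B ∈ π → D ≡ map odd B → Source D
      dual : ∀ C → C ∈ classes → D ≡ map even C → Source D

    source : ∀ {D} → D ∈ combine π classes → Source D
    source D∈ with ∈-++⁻ (map (map odd) π) D∈
    ... | inj₁ p = let (B , B∈ , eq) = ∈-map⁻ (map odd) p in primal B B∈ eq
    ... | inj₂ p = let (C , C∈ , eq) = ∈-map⁻ (map even) p in dual C C∈ eq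

    -- In the mixed cases a crossing would exhibit a chord of a block of π lying over one point of
    -- the dual block and not over another, against `class-∼`.
    cross : ∀ {D E i j k l} → Source D → Source E →
      i < j → j < k → k < l → i ∈ D → k ∈ D → j ∈ E → l ∈ E → D ≡ E
    cross (primal B B∈ refl) (primal C C∈ refl) ij jk kl i∈ k∈ j∈ l∈
      with i , i∈ , refl ← ∈-map⁻ odd i∈ | k , k∈ , refl ← ∈-map⁻ odd k∈
         | j , j∈ , refl ← ∈-map⁻ odd j∈ | l , l∈ , refl ← ∈-map⁻ odd l∈ =
      cong (map odd) (nonCrossing-≤ isπ ncπ B∈ C∈ (<⇒≤ (odd<odd⇒< {i} {j} ij)) (<⇒≤ (odd<odd⇒< {j} {k} jk))
        (<⇒≤ (odd<odd⇒< {k} {l} kl)) i∈ k∈ j∈ l∈)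
    cross (primal B B∈ refl) (dual C C∈ refl) ij jk kl i∈ k∈ j∈ l∈
      with i , i∈ , refl ← ∈-map⁻ odd i∈ | k , k∈ , refl ← ∈-map⁻ odd k∈
         | j , j∈ , refl ← ∈-map⁻ even j∈ | l , l∈ , refl ← ∈-map⁻ even l∈ =
      ⊥-elim (<⇒≱ (proj₂ (apply (proj₁ (class-∼ C∈ j∈ l∈)) B∈ i∈ k∈ (odd<even⇒≤ {i} {j} ij) (even<odd⇒< {j} {k} jk)))
        (odd<even⇒≤ {k} {l} kl))
    cross (dual C C∈ refl) (primal B B∈ refl) ij jk kl i∈ k∈ j∈ l∈
      with i , i∈ , refl ← ∈-map⁻ even i∈ | k , k∈ , refl ← ∈-map⁻ even k∈
         | j , j∈ , refl ← ∈-map⁻ odd j∈ | l , l∈ , refl ← ∈-map⁻ odd l∈ =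
      ⊥-elim (<⇒≱ (even<odd⇒< {i} {j} ij)
        (proj₁ (apply (proj₁ (class-∼ C∈ k∈ i∈)) B∈ j∈ l∈ (odd<even⇒≤ {j} {k} jk) (even<odd⇒< {k} {l} kl))))
    cross (dual C C∈ refl) (dual D D∈ refl) ij jk kl i∈ k∈ j∈ l∈
      with i , i∈ , refl ← ∈-map⁻ even i∈ | k , k∈ , refl ← ∈-map⁻ even k∈
         | j , j∈ , refl ← ∈-map⁻ even j∈ | l , l∈ , refl ← ∈-map⁻ even l∈ =
      cong (map even) (classes-∼ C∈ D∈ i∈ j∈ (crossing-∼ (even<even⇒< {i} {j} ij) (even<even⇒< {j} {k} jk)
        (even<even⇒< {k} {l} kl) (class-∼ C∈ i∈ k∈) (class-∼ D∈ j∈ l∈)))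

    noncrossing : NonCrossing (combine π classes)
    noncrossing = mkNonCrossing λ D∈ E∈ → cross (source D∈) (source E∈)

    -- A chord from x to y lying over f but not over g would cross the chord from f′ to g′ on the
    -- circle. This makes the classes of ∼ the coarsest choice.
    block-⊑ : ∀ {τ C f g} → IsPartition n τ → NonCrossing (combine π τ) → C ∈ τ → f ∈ C → g ∈ C →
      ∀ {B x y} → B ∈ π → x ∈ B → y ∈ B → x ≤ f → f < y → x ≤ g × g < y
    block-⊑ {τ} {C} {f} {g} isτ nc C∈ f∈ g∈ {B} {x} {y} B∈ x∈ y∈ x≤f f<y = x≤g , g<y
      where
      B′∈ : map odd B ∈ combine π τ
      B′∈ = ∈-++⁺ˡ (∈-map⁺ (map odd) B∈)
      C′∈ : map even C ∈ combine π τ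
      C′∈ = ∈-++⁺ʳ (map (map odd) π) (∈-map⁺ (map even) C∈)
      1≤x : 1 ≤ x
      1≤x = proj₁ (range isπ B∈ x∈)
      B′≢C′ : map odd B ≢ map even C
      B′≢C′ eq with ∈-map⁻ even (subst (odd x ∈_) eq (∈-map⁺ odd x∈))
      ... | z , _ , eq′ = odd≢even {x} {z} 1≤x eq′
      g<y : g < y
      g<y = ≰⇒> λ y≤g → nc _ _ B′∈ C′∈ B′≢C′ (odd x) (even f) (odd y) (even g)
        (≤⇒odd<even 1≤x x≤f) (<⇒even<odd f<y) (≤⇒odd<even (proj₁ (range isπ B∈ y∈)) y≤g)
        (∈-map⁺ odd x∈) (∈-map⁺ odd y∈) (∈-map⁺ even f∈) (∈-map⁺ even g∈)
      x≤g : x ≤ g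
      x≤g = ≮⇒≥ λ g<x → nc _ _ C′∈ B′∈ (B′≢C′ ∘ sym) (even g) (odd x) (even f) (odd y)
        (<⇒even<odd g<x) (≤⇒odd<even 1≤x x≤f) (<⇒even<odd f<y)
        (∈-map⁺ even g∈) (∈-map⁺ even f∈) (∈-map⁺ odd x∈) (∈-map⁺ odd y∈)

  classes-isKrewerasDual : IsKrewerasDual n π classes
  classes-isKrewerasDual = classes-isPartition , noncrossing , coarsest
    where
    coarsest : ∀ τ → IsPartition n τ → NonCrossing (combine π τ) → Refines τ classes
    coarsest τ isτ nc C C∈ = class h , class-∈ (proj₁ (range isτ C∈ h∈)) (proj₂ (range isτ C∈ h∈)) , λ {g} g∈ →
      ∈-class⁺ (proj₁ (range isτ C∈ g∈)) (proj₂ (range isτ C∈ g∈))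
        (⟨ block-⊑ isτ nc C∈ h∈ g∈ ⟩ , ⟨ block-⊑ isτ nc C∈ g∈ h∈ ⟩)
      where
      h : ℕ
      h = hd C
      h∈ : h ∈ C
      h∈ = hd-∈ (block-≢[] isτ C∈)

  -- `InNC` supplies its dual existentially; uniqueness identifies it with the explicit `classes`,
  -- about which the size condition can then be used.
  krewerasDual-unique : ∀ {τ} → IsKrewerasDual n π τ → τ ≡ classes
  krewerasDual-unique {τ} (isτ , nc , coarse) =
    refines-antisym isτ classes-isPartition (proj₂ (proj₂ classes-isKrewerasDual) τ isτ nc)
      (coarse classes classes-isPartition noncrossing)

-- Congruence modulo d

module Modular (d : ℕ) where

  infix 4 _≋_

  -- Adding multiples of d on both sides keeps the relation symmetric and avoids truncated
  -- subtraction.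
  record _≋_ (a b : ℕ) : Set where
    constructor congruent
    field
      s t : ℕ
      equation : a + s * d ≡ b + t * d

  ≋-refl : ∀ {a} → a ≋ a
  ≋-refl = congruent 0 0 refl

  ≋-reflexive : ∀ {a b} → a ≡ b → a ≋ b
  ≋-reflexive refl = ≋-refl

  ≋-sym : ∀ {a b} → a ≋ b → b ≋ a
  ≋-sym (congruent s t e) = congruent t s (sym e)

  private
    regroup : ∀ a s u d → a + (s + u) * d ≡ a + s * d + u * d
    regroup = solve-∀
    exchange : ∀ b t u d → b + t * d + u * d ≡ b + u * d + t * d
    exchange = solve-∀
    interleave : ∀ a b s u d → a + b + (s + u) * d ≡ (a + s * d) + (b + u * d)
    interleave = solve-∀

  ≋-trans : ∀ {a b c} → a ≋ b → b ≋ c → a ≋ c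
  ≋-trans {a} {b} {c} (congruent s t e) (congruent u v f) = congruent (s + u) (v + t) (begin
    a + (s + u) * d     ≡⟨ regroup a s u d ⟩
    a + s * d + u * d   ≡⟨ cong (_+ u * d) e ⟩
    b + t * d + u * d   ≡⟨ exchange b t u d ⟩
    b + u * d + t * d   ≡⟨ cong (_+ t * d) f ⟩
    c + v * d + t * d   ≡⟨ regroup c v t d ⟨
    c + (v + t) * d     ∎)
    where open ≡-Reasoning

  ≋-+ : ∀ {a b a′ b′} → a ≋ b → a′ ≋ b′ → a + a′ ≋ b + b′
  ≋-+ {a} {b} {a′} {b′} (congruent s t e) (congruent u v f) =
    congruent (s + u) (t + v) (trans (interleave a a′ s u d) (trans (cong₂ _+_ e f) (sym (interleave b b′ t v d))))

  ≋-+-cancelˡ : ∀ c {a b} → c + a ≋ c + b → a ≋ b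
  ≋-+-cancelˡ c {a} {b} (congruent s t e) =
    congruent s t (+-cancelˡ-≡ c _ _ (trans (sym (+-assoc c a _)) (trans e (+-assoc c b _))))

  ≋-suc : ∀ {a b} → a ≋ b → suc a ≋ suc b
  ≋-suc = ≋-+ (≋-refl {1})

  ≋-pred : ∀ {a b} → suc a ≋ suc b → a ≋ b
  ≋-pred = ≋-+-cancelˡ 1

  +-multiple-≋ : ∀ a q → a + q * d ≋ a
  +-multiple-≋ a q = congruent 0 q (+-identityʳ _)

  module _ .{{_ : NonZero d}} where

    ≋⇒% : ∀ {a b} → a ≋ b → a % d ≡ b % d
    ≋⇒% {a} {b} (congruent s t e) =
      trans (sym ([m+kn]%n≡m%n a s d)) (trans (cong (_% d) e) ([m+kn]%n≡m%n b t d))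

    %⇒≋ : ∀ {a b} → a % d ≡ b % d → a ≋ b
    %⇒≋ {a} {b} e = congruent (b / d) (a / d) (begin
      a + b / d * d                 ≡⟨ cong (_+ b / d * d) (m≡m%n+[m/n]*n a d) ⟩
      a % d + a / d * d + b / d * d ≡⟨ cong (λ r → r + a / d * d + b / d * d) e ⟩
      b % d + a / d * d + b / d * d ≡⟨ exchange (b % d) (a / d) (b / d) d ⟩
      b % d + b / d * d + a / d * d ≡⟨ cong (_+ a / d * d) (m≡m%n+[m/n]*n b d) ⟨
      b + a / d * d                 ∎)
      where open ≡-Reasoning

    -- Here d divides `suc a`, which is positive. In this way a face with a second element is known
    -- to have at least d + 1.
    ≋1⇒d< : ∀ {a} → suc (suc a) ≋ 1 → d < suc (suc a)
    ≋1⇒d< {a} (congruent s t e) = s≤s (∣⇒≤ (∣m+n∣m⇒∣n {m = s * d}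
      (divides t (trans (+-comm (s * d) (suc a)) (suc-injective e))) (n∣m*n s)))

  -- The entry at position j, counted from 0, is ≡ a + j. Anchoring the residues at a, instead of
  -- recording differences, lets progressions be cut and concatenated.
  data AP : ℕ → List ℕ → Set where
    [] : ∀ {a} → AP a []
    _∷_ : ∀ {a x L} → x ≋ a → AP (suc a) L → AP a (x ∷ L)

  AP-cong : ∀ {a b L} → a ≋ b → AP a L → AP b L
  AP-cong e [] = []
  AP-cong e (p ∷ ps) = ≋-trans p e ∷ AP-cong (≋-suc e) ps

  private
    AP-≡ : ∀ {a b L} → a ≡ b → AP a L → AP b L
    AP-≡ refl ps = ps

  AP-++⁻ˡ : ∀ P {Q a} → AP a (P ++ Q) → AP a P
  AP-++⁻ˡ [] _ = []
  AP-++⁻ˡ (x ∷ P) (p ∷ ps) = p ∷ AP-++⁻ˡ P ps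

  AP-++⁻ʳ : ∀ P {Q a} → AP a (P ++ Q) → AP (a + length P) Q
  AP-++⁻ʳ [] ps = AP-≡ (sym (+-identityʳ _)) ps
  AP-++⁻ʳ (x ∷ P) (p ∷ ps) = AP-≡ (sym (+-suc _ _)) (AP-++⁻ʳ P ps)

  AP-++⁺ : ∀ {P Q a} → AP a P → AP (a + length P) Q → AP a (P ++ Q)
  AP-++⁺ [] qs = AP-≡ (+-identityʳ _) qs
  AP-++⁺ (p ∷ ps) qs = p ∷ AP-++⁺ ps (AP-≡ (+-suc _ _) qs)

  AP-take : ∀ m {a L} → AP a L → AP a (take m L)
  AP-take zero _ = []
  AP-take (suc m) [] = []
  AP-take (suc m) (p ∷ ps) = p ∷ AP-take m ps

  AP-hd : ∀ {a L} → L ≢ [] → AP a L → hd L ≋ a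
  AP-hd ne [] = ⊥-elim (ne refl)
  AP-hd _ (p ∷ _) = p

  AP-lst : ∀ {a L} → L ≢ [] → AP a L → suc (lst L) ≋ a + length L
  AP-lst ne [] = ⊥-elim (ne refl)
  AP-lst {a} _ (p ∷ []) = ≋-trans (≋-suc p) (≋-reflexive (+-comm 1 a))
  AP-lst {a} {_ ∷ L} _ (p ∷ ps@(_ ∷ _)) = ≋-trans (AP-lst (λ ()) ps) (≋-reflexive (sym (+-suc a (length L))))

  AP-interval : ∀ x l → AP x (interval x l)
  AP-interval x zero = []
  AP-interval x (suc l) = ≋-refl ∷ AP-interval (suc x) l

  AP-Consec : ∀ {a L p h} → Increasing L → AP a L → Consec L p h → h ≋ suc p
  AP-Consec inc _ (consec (here refl) (here refl) p<h gap) = ⊥-elim (<-irrefl refl p<h)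
  AP-Consec inc (p ∷ q ∷ _) (consec (here refl) (there (here refl)) p<h gap) = ≋-trans q (≋-suc (≋-sym p))
  AP-Consec {L = _ ∷ _ ∷ _} ((x<y ∷ _) ∷ y< ∷ _) _ (consec (here refl) (there (there h∈)) p<h gap) with gap (there (here refl))
  ... | inj₁ y≤x = ⊥-elim (<⇒≱ x<y y≤x)
  ... | inj₂ h≤y = ⊥-elim (<⇒≱ (All.lookup y< h∈) h≤y)
  AP-Consec (x< ∷ _) _ (consec (there p∈) (here refl) p<h gap) = ⊥-elim (<-asym p<h (All.lookup x< p∈))
  AP-Consec (_ ∷ inc) (_ ∷ ps) (consec (there p∈) (there h∈) p<h gap) = AP-Consec inc ps (consec p∈ h∈ p<h (gap ∘ there))

  Consec-AP : ∀ {L} → Increasing L → (∀ {p h} → Consec L p h → h ≋ suc p) → AP (hd L) L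
  Consec-AP [] _ = []
  Consec-AP {_ ∷ []} _ _ = ≋-refl ∷ []
  Consec-AP {_ ∷ _ ∷ _} inc@(x< ∷ inc′) step =
    ≋-refl ∷ AP-cong (step (Consec-here inc)) (Consec-AP inc′ (step ∘ Consec-there x<))

  record GoodBlock (B : Block) : Set where
    constructor goodBlock
    field
      progression : AP (hd B) B
      size : length B ≋ 1

  open GoodBlock public

  -- The last entry of a progression is ≡ its first entry + length - 1. So a size ≡ 1 amounts to
  -- congruent ends, which is how conditions on sizes are converted into conditions on steps.
  lst≋hd : ∀ {B} → B ≢ [] → GoodBlock B → lst B ≋ hd B
  lst≋hd {B} ne (goodBlock ap sz) = ≋-pred (≋-trans (AP-lst ne ap)
    (≋-trans (≋-+ (≋-refl {hd B}) sz) (≋-reflexive (+-comm (hd B) 1))))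

  lst≋⇒size : ∀ {a B} → B ≢ [] → AP a B → lst B ≋ a → length B ≋ 1
  lst≋⇒size {a} ne ap e = ≋-+-cancelˡ a (≋-trans (≋-sym (AP-lst ne ap)) (≋-trans (≋-suc e) (≋-reflexive (+-comm 1 a))))

  record Good (n : ℕ) (π : Partition) : Set where
    constructor good
    field
      isPartition : IsPartition n π
      nonCrossing : NonCrossing π
      goodBlocks  : ∀ {B} → B ∈ π → GoodBlock B

-- A face is a class of ∼ inside a block B of a coarser partition σ.
module Face {n π σ} (isπ : IsPartition n π) (ncπ : NonCrossing π) (isσ : IsPartition n σ) (ncσ : NonCrossing σ)
  (π≤σ : Refines π σ) {B} (B∈ : B ∈ σ) where

  open Separation π

  private
    B↑ : Increasing B
    B↑ = block-increasing isσ B∈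

    -- The block of σ that contains D meets B in the weakly crossing pattern x ≤ f ≤ y ≤ h, so it is
    -- B itself.
    straddleʳ : ∀ {D x y f h} → D ∈ π → x ∈ D → y ∈ D → f ∈ B → h ∈ B → x ≤ f → f ≤ y → y ≤ h → D ⊆ B
    straddleʳ {D} D∈ x∈ y∈ f∈ h∈ x≤f f≤y y≤h with E , E∈ , D⊆E ← π≤σ D D∈
      with refl ← nonCrossing-≤ isσ ncσ E∈ B∈ x≤f f≤y y≤h (D⊆E x∈) (D⊆E y∈) f∈ h∈ = D⊆E

    straddleˡ : ∀ {D x y f h} → D ∈ π → x ∈ D → y ∈ D → f ∈ B → h ∈ B → f ≤ x → x ≤ h → h ≤ y → D ⊆ B
    straddleˡ {D} D∈ x∈ y∈ f∈ h∈ f≤x x≤h h≤y with E , E∈ , D⊆E ← π≤σ D D∈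
      with refl ← nonCrossing-≤ isσ ncσ B∈ E∈ f≤x x≤h h≤y f∈ h∈ (D⊆E x∈) (D⊆E y∈) = D⊆E

    within-gap : ∀ {p h y} → Consec B p h → y ∈ B → p < y → y < h → ⊥
    within-gap con y∈ p<y y<h with Consec.gap con y∈
    ... | inj₁ y≤p = <⇒≱ p<y y≤p
    ... | inj₂ h≤y = <⇒≱ y<h h≤y

  -- A chord separating f from `lst C` has an end between them. In the gap before `hd C`,
  -- noncrossing of σ would force this end into B, which has no element there; within the span of C
  -- the chord would cross C. Together with `within-block-∼` this says that the predecessor in B of
  -- any element h is ∼ to the cyclic predecessor of h in its block of π.
  before-block-∼ : ∀ {C f} → C ∈ π → Consec B f (hd C) → f ∼ lst C
  before-block-∼ {C} {f} C∈ con = ⟨ forward ⟩ , ⟨ backward ⟩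
    where
    h∈ : hd C ∈ C
    h∈ = hd-∈ (block-≢[] isπ C∈)
    c∈ : lst C ∈ C
    c∈ = lst-∈ (block-≢[] isπ C∈)
    h≤c : hd C ≤ lst C
    h≤c = hd-≤ (block-increasing isπ C∈) c∈
    f<h : f < hd C
    f<h = Consec.less con
    forward : ∀ {D x y} → D ∈ π → x ∈ D → y ∈ D → x ≤ f → f < y → x ≤ lst C × lst C < y
    forward {D} {x} {y} D∈ x∈ y∈ x≤f f<y = ≤-trans x≤f (≤-trans (<⇒≤ f<h) h≤c) , ≰⇒> impossible
      where
      impossible : y ≤ lst C → ⊥
      impossible y≤c with hd C ≤? y
      ... | no h≰y = within-gap con (straddleʳ D∈ x∈ y∈ (Consec.left con) (Consec.right con) x≤f (<⇒≤ f<y) (≰⇒≥ h≰y) y∈) f<y (≰⇒> h≰y)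
      ... | yes h≤y with refl ← nonCrossing-≤ isπ ncπ D∈ C∈ (≤-trans x≤f (<⇒≤ f<h)) h≤y y≤c x∈ y∈ h∈ c∈ =
        <⇒≱ f<h (≤-trans (hd-≤ (block-increasing isπ C∈) x∈) x≤f)
    backward : ∀ {D x y} → D ∈ π → x ∈ D → y ∈ D → x ≤ lst C → lst C < y → x ≤ f × f < y
    backward {D} {x} {y} D∈ x∈ y∈ x≤c c<y = ≮⇒≥ impossible , <-trans f<h (≤-<-trans h≤c c<y)
      where
      impossible : f < x → ⊥
      impossible f<x with hd C ≤? x
      ... | no h≰x = within-gap con (straddleˡ D∈ x∈ y∈ (Consec.left con) (Consec.right con) (<⇒≤ f<x) (≰⇒≥ h≰x)
                       (≤-trans h≤c (<⇒≤ c<y)) x∈) f<x (≰⇒> h≰x)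
      ... | yes h≤x with refl ← nonCrossing-≤ isπ ncπ C∈ D∈ h≤x x≤c (<⇒≤ c<y) h∈ c∈ x∈ y∈ =
        <⇒≱ c<y (≤-lst (block-increasing isπ C∈) y∈)

  -- The counterpart of `before-block-∼` for an element h that does not open its block: a separating
  -- chord would end in a gap of B or cross the chord of C from q to h.
  within-block-∼ : ∀ {C p q h} → C ∈ π → C ⊆ B → Consec B p h → Consec C q h → q ∼ p
  within-block-∼ {C} {p} {q} {h} C∈ C⊆B con conC = ⟨ forward ⟩ , ⟨ backward ⟩
    where
    q∈ : q ∈ C
    q∈ = Consec.left conC
    h∈ : h ∈ C
    h∈ = Consec.right conC
    q≤p : q ≤ p
    q≤p with Consec.gap con (C⊆B q∈)
    ... | inj₁ q≤p = q≤p
    ... | inj₂ h≤q = ⊥-elim (<⇒≱ (Consec.less conC) h≤q)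
    outside : ∀ {y} → y ∈ C → q < y → y < h → ⊥
    outside y∈ q<y y<h with Consec.gap conC y∈
    ... | inj₁ y≤q = <⇒≱ q<y y≤q
    ... | inj₂ h≤y = <⇒≱ y<h h≤y
    forward : ∀ {D x y} → D ∈ π → x ∈ D → y ∈ D → x ≤ q → q < y → x ≤ p × p < y
    forward {D} {x} {y} D∈ x∈ y∈ x≤q q<y = ≤-trans x≤q q≤p , ≰⇒> impossible
      where
      impossible : y ≤ p → ⊥
      impossible y≤p with refl ← nonCrossing-≤ isπ ncπ D∈ C∈ x≤q (<⇒≤ q<y) (≤-trans y≤p (<⇒≤ (Consec.less con))) x∈ y∈ q∈ h∈ =
        outside y∈ q<y (≤-<-trans y≤p (Consec.less con))
    backward : ∀ {D x y} → D ∈ π → x ∈ D → y ∈ D → x ≤ p → p < y → x ≤ q × q < y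
    backward {D} {x} {y} D∈ x∈ y∈ x≤p p<y = ≮⇒≥ impossible , ≤-<-trans q≤p p<y
      where
      x<h : x < h
      x<h = ≤-<-trans x≤p (Consec.less con)
      impossible : q < x → ⊥
      impossible q<x with h ≤? y
      ... | no h≰y = within-gap con (straddleʳ D∈ x∈ y∈ (Consec.left con) (Consec.right con) x≤p (<⇒≤ p<y) (≰⇒≥ h≰y) y∈) p<y (≰⇒> h≰y)
      ... | yes h≤y with refl ← nonCrossing-≤ isπ ncπ C∈ D∈ (<⇒≤ q<x) (<⇒≤ x<h) h≤y q∈ h∈ x∈ y∈ = outside x∈ q<x x<h

  block-of : ∀ {x} → x ∈ B → ∃ λ C → C ∈ π × x ∈ C × C ⊆ B
  block-of x∈ with range isσ B∈ x∈
  ... | a , b with cover isπ a b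
  ... | C , C∈ , x∈C = C , C∈ , x∈C , refines-⊆ isσ π≤σ C∈ B∈ x∈C x∈

  abstract
    face : ℕ → Block
    face p = filter (p ∼?_) B

    face-filter : ∀ p → face p ≡ filter (p ∼?_) B
    face-filter _ = refl

    ∈-face⁺ : ∀ {p f} → f ∈ B → p ∼ f → f ∈ face p
    ∈-face⁺ {p} = ∈-filter⁺ (p ∼?_)

    ∈-face⁻ : ∀ {p f} → f ∈ face p → f ∈ B × p ∼ f
    ∈-face⁻ {p} = ∈-filter⁻ (p ∼?_) {xs = B}

    face-increasing : ∀ p → Increasing (face p)
    face-increasing p = AllPairsₚ.filter⁺ (p ∼?_) B↑

  face-∼ : ∀ {p f g} → f ∈ face p → g ∈ face p → f ∼ g
  face-∼ f∈ g∈ = ∼-trans (∼-sym (proj₂ (∈-face⁻ f∈))) (proj₂ (∈-face⁻ g∈))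

  face-extend : ∀ {p f g} → f ∈ face p → g ∈ B → f ∼ g → g ∈ face p
  face-extend f∈ g∈ f∼g = ∈-face⁺ g∈ (∼-trans (proj₂ (∈-face⁻ f∈)) f∼g)

  -- The successor h of f in B opens its block C, since otherwise a chord of C would lie over f and
  -- end at h ≤ g. By `before-block-∼` the element `lst C` is in the face, so g ≤ `lst C`; if this
  -- were strict, a chord of C would lie over g and not over f.
  face-Consec : ∀ {p f g} → Consec (face p) f g → ∃ λ C → C ∈ π × Consec B f (hd C) × lst C ≡ g
  face-Consec {p} {f} {g} (consec f∈ g∈ f<g gap) with next B↑ (proj₁ (∈-face⁻ f∈))
  ... | inj₁ refl = ⊥-elim (<⇒≱ f<g (≤-lst B↑ (proj₁ (∈-face⁻ g∈))))
  ... | inj₂ (h , con) with block-of (Consec.right con)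
  ... | C , C∈ , h∈C , C⊆B = C , C∈ , con′ , ≤-antisym c≤g g≤c
    where
    h≤g : h ≤ g
    h≤g with Consec.gap con (proj₁ (∈-face⁻ g∈))
    ... | inj₁ g≤f = ⊥-elim (<⇒≱ f<g g≤f)
    ... | inj₂ h≤g = h≤g
    hd∈ : hd C ∈ C
    hd∈ = hd-∈ (block-≢[] isπ C∈)
    lst∈ : lst C ∈ C
    lst∈ = lst-∈ (block-≢[] isπ C∈)
    h≤hd : h ≤ hd C
    h≤hd with Consec.gap con (C⊆B hd∈)
    ... | inj₂ h≤y = h≤y
    ... | inj₁ y≤f = ⊥-elim (<⇒≱ (proj₂ (apply (proj₁ (face-∼ f∈ g∈)) C∈ hd∈ h∈C y≤f (Consec.less con))) h≤g)
    hd≡ : h ≡ hd C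
    hd≡ = ≤-antisym h≤hd (hd-≤ (block-increasing isπ C∈) h∈C)
    con′ : Consec B f (hd C)
    con′ = subst (Consec B f) hd≡ con
    g≤c : g ≤ lst C
    g≤c with gap (face-extend f∈ (C⊆B lst∈) (before-block-∼ C∈ con′))
    ... | inj₁ c≤f = ⊥-elim (<⇒≱ (Consec.less con) (≤-trans (≤-lst (block-increasing isπ C∈) h∈C) c≤f))
    ... | inj₂ g≤c = g≤c
    c≤g : lst C ≤ g
    c≤g = ≮⇒≥ λ g<c → <⇒≱ (Consec.less con) (proj₁ (apply (proj₂ (face-∼ f∈ g∈)) C∈ h∈C lst∈ h≤g g<c))

  -- The step of `face-Consec`, taken from the last element of the face, closes the cycle at the
  -- first one. Either it wraps around from the end of B to its beginning, or the successor h in B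
  -- continues a block C whose element before h is the first element of the face.
  face-ends : ∀ {p} → p ∈ B →
    (∃ λ D → D ∈ π × hd D ≡ hd B × lst D ≡ hd (face p) × lst (face p) ≡ lst B)
    ⊎ (∃ λ C → ∃ λ h → C ∈ π × Consec B (lst (face p)) h × Consec C (hd (face p)) h)
  face-ends {p} p∈ = ends
    where
    F : Block
    F = face p
    F≢[] : F ≢ []
    F≢[] = ∈⇒≢[] (∈-face⁺ p∈ ∼-refl)
    first∈ : hd F ∈ F
    first∈ = hd-∈ F≢[]
    last∈ : lst F ∈ F
    last∈ = lst-∈ F≢[]
    first≤ : ∀ {f} → f ∈ F → hd F ≤ f
    first≤ = hd-≤ (face-increasing p)
    last-of-block : ∀ {D} → lst F ≡ lst B → D ∈ π → D ⊆ B → hd F ∈ D → lst D ≡ hd F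
    last-of-block {D} last≡ D∈ D⊆B first∈D = ≤-antisym lst≤ (≤-lst (block-increasing isπ D∈) first∈D)
      where
      lst≤ : lst D ≤ hd F
      lst≤ = ≮⇒≥ λ first<y → <⇒≱
        (proj₂ (apply (proj₁ (face-∼ first∈ last∈)) D∈ first∈D (lst-∈ (block-≢[] isπ D∈)) ≤-refl first<y))
        (subst (lst D ≤_) (sym last≡) (≤-lst B↑ (D⊆B (lst-∈ (block-≢[] isπ D∈)))))
    ends : (∃ λ D → D ∈ π × hd D ≡ hd B × lst D ≡ hd F × lst F ≡ lst B)
      ⊎ (∃ λ C → ∃ λ h → C ∈ π × Consec B (lst F) h × Consec C (hd F) h)
    ends with next B↑ (proj₁ (∈-face⁻ last∈))
    ends | inj₁ last≡ with block-of (proj₁ (∈-face⁻ first∈))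
    ... | D , D∈ , first∈D , D⊆B with prev B↑ (D⊆B (hd-∈ (block-≢[] isπ D∈)))
    ... | inj₁ hd≡ = inj₁ (D , D∈ , hd≡ , last-of-block last≡ D∈ D⊆B first∈D , last≡)
    ... | inj₂ (p′ , con) = ⊥-elim (<⇒≱ (<-≤-trans (Consec.less con) (hd-≤ (block-increasing isπ D∈) first∈D))
            (first≤ (face-extend first∈ (Consec.left con)
              (∼-sym (subst (p′ ∼_) (last-of-block last≡ D∈ D⊆B first∈D) (before-block-∼ D∈ con))))))
    ends | inj₂ (h , con) with block-of (Consec.right con)
    ... | C , C∈ , h∈ , C⊆B with prev (block-increasing isπ C∈) h∈
    ... | inj₁ refl = ⊥-elim (<⇒≱ (<-≤-trans (Consec.less con) (≤-lst (block-increasing isπ C∈) h∈))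
            (≤-lst (face-increasing p) (face-extend last∈ (C⊆B (lst-∈ (block-≢[] isπ C∈))) (before-block-∼ C∈ con))))
    ... | inj₂ (q , conC) with within-block-∼ C∈ C⊆B con conC
    ... | q∼last = inj₂ (C , h , C∈ , con , subst (λ z → Consec C z h) (sym first≡q) conC)
      where
      q∈F : q ∈ F
      q∈F = face-extend last∈ (C⊆B (Consec.left conC)) (∼-sym q∼last)
      first≡q : hd F ≡ q
      first≡q = ≤-antisym (first≤ q∈F) (proj₁ (apply (proj₁ (face-∼ last∈ first∈)) C∈ (Consec.left conC) h∈
        (≤-lst (face-increasing p) q∈F) (Consec.less con)))

  module _ (d : ℕ) where

    open Modular d

    -- A step of the face passes over one block C with congruent ends, so modulo d it equals the
    -- step from f to its successor in B. `face-ends` yields congruent ends of the face, that is, a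
    -- size ≡ 1.
    face-good : GoodBlock B → (∀ {C} → C ∈ π → GoodBlock C) → ∀ {p} → p ∈ B → GoodBlock (face p)
    face-good goodB goodπ {p} p∈ = goodBlock ap (lst≋⇒size (∈⇒≢[] (∈-face⁺ p∈ ∼-refl)) ap (ends (face-ends p∈)))
      where
      block-lst≋hd : ∀ {C} → C ∈ π → lst C ≋ hd C
      block-lst≋hd C∈ = lst≋hd (block-≢[] isπ C∈) (goodπ C∈)
      step : ∀ {f g} → Consec (face p) f g → g ≋ suc f
      step con with face-Consec con
      ... | C , C∈ , conB , refl = ≋-trans (block-lst≋hd C∈) (AP-Consec B↑ (progression goodB) conB)
      ap : AP (hd (face p)) (face p)
      ap = Consec-AP (face-increasing p) step
      ends : (∃ λ D → D ∈ π × hd D ≡ hd B × lst D ≡ hd (face p) × lst (face p) ≡ lst B)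
        ⊎ (∃ λ C → ∃ λ h → C ∈ π × Consec B (lst (face p)) h × Consec C (hd (face p)) h) →
        lst (face p) ≋ hd (face p)
      ends (inj₁ (D , D∈ , e₁ , e₂ , e₃)) = ≋-trans (≋-reflexive e₃) (≋-trans (lst≋hd (block-≢[] isσ B∈) goodB)
        (≋-trans (≋-reflexive (sym e₁)) (≋-trans (≋-sym (block-lst≋hd D∈)) (≋-reflexive e₂))))
      ends (inj₂ (C , h , C∈ , con , conC)) = ≋-pred (≋-trans (≋-sym (AP-Consec B↑ (progression goodB) con))
        (AP-Consec (block-increasing isπ C∈) (progression (goodπ C∈)) conC))

-- The greatest and the least partition

interval-suc : ∀ x n → map suc (interval x n) ≡ interval (suc x) n
interval-suc x zero = refl
interval-suc x (suc n) = cong (suc x ∷_) (interval-suc (suc x) n)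

upTo-interval : ∀ n → upTo n ≡ interval 0 n
upTo-interval n = go id 0 n (λ i → sym (+-identityʳ i))
  where
  go : ∀ f x n → (∀ i → f i ≡ i + x) → applyUpTo f n ≡ interval x n
  go f x zero _ = refl
  go f x (suc n) h = cong₂ _∷_ (h 0) (go (f ∘ suc) (suc x) n λ i → trans (h (suc i)) (sym (+-suc i x)))

top-interval : ∀ n → top n ≡ interval 1 n ∷ []
top-interval n = cong (_∷ []) (trans (cong (map suc) (upTo-interval n)) (interval-suc 0 n))

bottom-interval : ∀ n → bottom n ≡ map (_∷ []) (interval 1 n)
bottom-interval n = trans (map-∘ (upTo n)) (cong (map (_∷ [])) (trans (cong (map suc) (upTo-interval n)) (interval-suc 0 n)))

∈-top⁻ : ∀ {n B} → B ∈ top n → B ≡ interval 1 n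
∈-top⁻ {n} {B} B∈ with here eq ← subst (B ∈_) (top-interval n) B∈ = eq

interval-∈-top : ∀ n → interval 1 n ∈ top n
interval-∈-top n = subst (interval 1 n ∈_) (sym (top-interval n)) (here refl)

top-isPartition : ∀ n → IsPartition (suc n) (top (suc n))
top-isPartition n = subst (IsPartition (suc n)) (sym (top-interval (suc n))) (mkPartition {P = interval 1 (suc n) ∷ []}
  (λ where (here refl) → (λ ()) , interval-increasing 1 (suc n))
  ([] ∷ [])
  (λ where (here refl) i∈ → let (a , b) = ∈-interval⁻ 1 (suc n) i∈ in a , ≤-pred b)
  (λ a b → _ , here refl , ∈-interval⁺ 1 (suc n) a (s≤s b))
  (λ where (here refl) (here refl) _ _ → refl))

top-nonCrossing : ∀ n → NonCrossing (top n)
top-nonCrossing n B C B∈ C∈ B≢C = ⊥-elim (B≢C (trans (∈-top⁻ {n} B∈) (sym (∈-top⁻ {n} C∈))))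

refines-top : ∀ {n π} → IsPartition n π → Refines π (top n)
refines-top {n} isπ B B∈ = interval 1 n , interval-∈-top n ,
  λ i∈ → ∈-interval⁺ 1 n (proj₁ (range isπ B∈ i∈)) (s≤s (proj₂ (range isπ B∈ i∈)))

∈-bottom⁻ : ∀ {n B} → B ∈ bottom n → ∃ λ x → (1 ≤ x × x ≤ n) × B ≡ x ∷ []
∈-bottom⁻ {n} {B} B∈ with ∈-map⁻ (_∷ []) (subst (B ∈_) (bottom-interval n) B∈)
... | x , x∈ , refl with ∈-interval⁻ 1 n x∈
... | a , b = x , (a , ≤-pred b) , refl

∈-bottom⁺ : ∀ {n x} → 1 ≤ x → x ≤ n → (x ∷ []) ∈ bottom n
∈-bottom⁺ {n} {x} a b = subst ((x ∷ []) ∈_) (sym (bottom-interval n)) (∈-map⁺ (_∷ []) (∈-interval⁺ 1 n a (s≤s b)))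

bottom-isPartition : ∀ n → IsPartition n (bottom n)
bottom-isPartition n = mkPartition blocks heads′ range′ (λ a b → _ , ∈-bottom⁺ a b , here refl) uniq′
  where
  blocks : ∀ {B} → B ∈ bottom n → B ≢ [] × Increasing B
  blocks B∈ with _ , _ , refl ← ∈-bottom⁻ {n} B∈ = (λ ()) , [] ∷ []
  heads′ : AllPairs _<ʰ_ (bottom n)
  heads′ = subst (AllPairs _<ʰ_) (sym (bottom-interval n)) (AllPairsₚ.map⁺ (interval-increasing 1 n))
  range′ : ∀ {B i} → B ∈ bottom n → i ∈ B → 1 ≤ i × i ≤ n
  range′ B∈ i∈ with _ , r , refl ← ∈-bottom⁻ {n} B∈ with here refl ← i∈ = r
  uniq′ : ∀ {B C i} → B ∈ bottom n → C ∈ bottom n → i ∈ B → i ∈ C → B ≡ C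
  uniq′ B∈ C∈ i∈B i∈C with _ , _ , refl ← ∈-bottom⁻ {n} B∈ | _ , _ , refl ← ∈-bottom⁻ {n} C∈
    with here refl ← i∈B | here refl ← i∈C = refl

-- The elements of a face follow each other at distance ≡ 1 exactly when the blocks lying between them
-- have size ≡ 1; this trades the condition on π′ for one on the blocks of π alone.
module Criterion (d m : ℕ) .{{_ : NonZero d}} (size-≋ : Modular._≋_ d (suc m) 1) where

  open Modular d

  private
    n : ℕ
    n = suc m

  module _ {π} (isπ : IsPartition n π) (ncπ : NonCrossing π) where
    private
      module F = Face isπ ncπ (top-isPartition m) (top-nonCrossing n) (refines-top isπ) (interval-∈-top n)
      module K = Dual isπ ncπ
    open Separation π

    private
      class-face : ∀ p → K.class p ≡ F.face p
      class-face p = trans (K.class-filter p) (sym (F.face-filter p))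

    good⇒dual-sizes : (∀ {B} → B ∈ π → GoodBlock B) → All (λ B → Cong1 d (length B)) K.classes
    good⇒dual-sizes goodπ = All.tabulate sizes
      where
      sizes : ∀ {B} → B ∈ K.classes → Cong1 d (length B)
      sizes B∈ with p , (a , b) , refl ← K.∈-classes⁻ B∈ = subst (λ B → Cong1 d (length B)) (sym (class-face p))
        (≋⇒% (size (F.face-good d
          (goodBlock (AP-interval 1 n) (≋-trans (≋-reflexive (length-interval 1 n)) size-≋)) goodπ (∈-interval⁺ 1 n a (s≤s b)))))

    module _ (sizes : All (λ B → Cong1 d (length B)) π) (dual-sizes : All (λ B → Cong1 d (length B)) K.classes) where

      private
        -- The face of p begins at p and ends at h - 1, so its size ≡ 1 gives h - 1 ≋ p once its own
        -- steps are known to be ≡ 1. Those steps pass over blocks D with `lst D` < h ≤ `lst C`,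
        -- which explains the recursion on the last element.
        step : ∀ {C} → C ∈ π → (∀ {D} → D ∈ π → lst D < lst C → AP (hd D) D) → ∀ {p h} → Consec C p h → h ≋ suc p
        step {C} C∈ smaller {p} {suc q} con = ≋-suc (≋-trans (≋-reflexive (sym last≡)) (≋-trans
          (lst≋hd F≢[] (goodBlock ap (≋-trans (≋-reflexive (cong length (sym (class-face p)))) (%⇒≋ (All.lookup dual-sizes (K.class-∈ 1≤p p≤n))))))
          (≋-reflexive first≡)))
          where
          p∈C : p ∈ C
          p∈C = Consec.left con
          1≤p : 1 ≤ p
          1≤p = proj₁ (range isπ C∈ p∈C)
          p≤n : p ≤ n
          p≤n = proj₂ (range isπ C∈ p∈C)
          p≤q : p ≤ q
          p≤q = ≤-pred (Consec.less con)
          q<n : q < n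
          q<n = proj₂ (range isπ C∈ (Consec.right con))
          p∈ : p ∈ interval 1 n
          p∈ = ∈-interval⁺ 1 n 1≤p (s≤s p≤n)
          q∈ : q ∈ interval 1 n
          q∈ = ∈-interval⁺ 1 n (≤-trans 1≤p p≤q) (m<n⇒m<1+n q<n)
          conI : Consec (interval 1 n) q (suc q)
          conI = consec q∈ (∈-interval⁺ 1 n (s≤s z≤n) (s≤s q<n)) ≤-refl (λ {y} _ → case y ≤? q of λ where
            (yes y≤q) → inj₁ y≤q
            (no y≰q) → inj₂ (≰⇒> y≰q))
          F : Block
          F = F.face p
          p∈F : p ∈ F
          p∈F = F.∈-face⁺ p∈ ∼-refl
          q∈F : q ∈ F
          q∈F = F.∈-face⁺ q∈ (F.within-block-∼ C∈ (proj₂ (proj₂ (refines-top isπ C C∈))) conI con)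
          F≢[] : F ≢ []
          F≢[] = ∈⇒≢[] p∈F
          between : ∀ {f} → f ∈ F → p ≤ f × f < suc q
          between f∈ = apply (proj₁ (proj₂ (F.∈-face⁻ f∈))) C∈ p∈C (Consec.right con) ≤-refl (Consec.less con)
          first≡ : hd F ≡ p
          first≡ = ≤-antisym (hd-≤ (F.face-increasing p) p∈F) (proj₁ (between (hd-∈ F≢[])))
          last≡ : lst F ≡ q
          last≡ = ≤-antisym (≤-pred (proj₂ (between (lst-∈ F≢[])))) (≤-lst (F.face-increasing p) q∈F)
          lst-between : ∀ {g} → g ∈ F → g < lst C
          lst-between g∈ = <-≤-trans (proj₂ (between g∈)) (≤-lst (block-increasing isπ C∈) (Consec.right con))
          interval-step : ∀ {f h} → Consec (interval 1 n) f h → h ≋ suc f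
          interval-step = AP-Consec (interval-increasing 1 n) (AP-interval 1 n)
          face-step : ∀ {f g} → Consec F f g → g ≋ suc f
          face-step conF = closing (Consec.right conF) (F.face-Consec conF)
            where
            closing : ∀ {f g} → g ∈ F → (∃ λ D → D ∈ π × Consec (interval 1 n) f (hd D) × lst D ≡ g) → g ≋ suc f
            closing g∈ (D , D∈ , conB , refl) = ≋-trans
              (lst≋hd (block-≢[] isπ D∈) (goodBlock (smaller D∈ (lst-between g∈)) (%⇒≋ (All.lookup sizes D∈))))
              (interval-step conB)
          ap : AP (hd F) F
          ap = Consec-AP (F.face-increasing p) face-step

        progression-acc : ∀ {C} → C ∈ π → Acc _<_ (lst C) → AP (hd C) C
        progression-acc C∈ (acc rec) = Consec-AP (block-increasing isπ C∈)
          (step C∈ (λ D∈ D<C → progression-acc D∈ (rec D<C)))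

      dual-sizes⇒good : ∀ {C} → C ∈ π → GoodBlock C
      dual-sizes⇒good C∈ = goodBlock (progression-acc C∈ (<-wellFounded _)) (%⇒≋ (All.lookup sizes C∈))

  Good⇒InNC : ∀ {π} → Good n π → InNC d n π
  Good⇒InNC (good isπ ncπ goodπ) = isπ , ncπ , All.tabulate (λ B∈ → ≋⇒% (size (goodπ B∈))) ,
    Dual.classes isπ ncπ , Dual.classes-isKrewerasDual isπ ncπ , good⇒dual-sizes isπ ncπ goodπ

  InNC⇒Good : ∀ {π} → InNC d n π → Good n π
  InNC⇒Good (isπ , ncπ , sizes , τ , isDual , dual-sizes) = good isπ ncπ (dual-sizes⇒good isπ ncπ sizes
    (subst (All (λ B → Cong1 d (length B))) (Dual.krewerasDual-unique isπ ncπ isDual) dual-sizes))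

  top-good : Good n (top n)
  top-good = good (top-isPartition m) (top-nonCrossing n) (λ B∈ → subst GoodBlock (sym (∈-top⁻ {n} B∈))
    (goodBlock (AP-interval 1 n) (≋-trans (≋-reflexive (length-interval 1 n)) size-≋)))

-- Cutting blocks

insert : Block → Partition → Partition
insert C [] = C ∷ []
insert C (D ∷ P) with hd C <? hd D
... | yes _ = C ∷ D ∷ P
... | no _ = D ∷ insert C P

∈-insert⁻ : ∀ {C D} P → D ∈ insert C P → D ≡ C ⊎ D ∈ P
∈-insert⁻ [] (here eq) = inj₁ eq
∈-insert⁻ {C} (E ∷ P) D∈ with hd C <? hd E
∈-insert⁻ (E ∷ P) (here eq) | yes _ = inj₁ eq
∈-insert⁻ (E ∷ P) (there D∈) | yes _ = inj₂ D∈
∈-insert⁻ (E ∷ P) (here eq) | no _ = inj₂ (here eq)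
∈-insert⁻ (E ∷ P) (there D∈) | no _ with ∈-insert⁻ P D∈
... | inj₁ eq = inj₁ eq
... | inj₂ D∈P = inj₂ (there D∈P)

∈-insert-new : ∀ C P → C ∈ insert C P
∈-insert-new C [] = here refl
∈-insert-new C (E ∷ P) with hd C <? hd E
... | yes _ = here refl
... | no _ = there (∈-insert-new C P)

∈-insert-old : ∀ {D} C P → D ∈ P → D ∈ insert C P
∈-insert-old C (E ∷ P) D∈ with hd C <? hd E
∈-insert-old C (E ∷ P) D∈ | yes _ = there D∈
∈-insert-old C (E ∷ P) (here eq) | no _ = here eq
∈-insert-old C (E ∷ P) (there D∈) | no _ = there (∈-insert-old C P D∈)

length-insert : ∀ C P → length (insert C P) ≡ suc (length P)
length-insert C [] = refl
length-insert C (E ∷ P) with hd C <? hd E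
... | yes _ = refl
... | no _ = cong suc (length-insert C P)

insert-sorted : ∀ {C P} → AllPairs _<ʰ_ P → (∀ {D} → D ∈ P → hd C ≢ hd D) → AllPairs _<ʰ_ (insert C P)
insert-sorted [] _ = [] ∷ []
insert-sorted {C} {E ∷ P} (E< ∷ sP) fresh with hd C <? hd E
... | yes C<E = (C<E ∷ All.map (<-trans C<E) E<) ∷ E< ∷ sP
... | no C≮E = All.tabulate (λ D∈ → above (∈-insert⁻ P D∈)) ∷ insert-sorted sP (fresh ∘ there)
  where
  above : ∀ {D} → D ≡ C ⊎ D ∈ P → hd E < hd D
  above (inj₁ refl) = ≤∧≢⇒< (≮⇒≥ C≮E) (fresh (here refl) ∘ sym)
  above (inj₂ D∈) = All.lookup E< D∈

replaceBlock : Block → Block → Block → Block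
replaceBlock B B′ D with D ≟ᴮ B
... | yes _ = B′
... | no _ = D

replaceBlock-yes : ∀ B B′ → replaceBlock B B′ B ≡ B′
replaceBlock-yes B B′ with B ≟ᴮ B
... | yes _ = refl
... | no B≢B = ⊥-elim (B≢B refl)

replaceBlock-no : ∀ {B B′ D} → D ≢ B → replaceBlock B B′ D ≡ D
replaceBlock-no {B} {B′} {D} D≢B with D ≟ᴮ B
... | yes eq = ⊥-elim (D≢B eq)
... | no _ = refl

hd-replaceBlock : ∀ {B B′} → hd B′ ≡ hd B → ∀ D → hd (replaceBlock B B′ D) ≡ hd D
hd-replaceBlock {B} eq D with D ≟ᴮ B
... | yes refl = eq
... | no _ = refl

replace : Block → Block → Partition → Partition
replace B B′ = map (replaceBlock B B′)

∈-replace⁻ : ∀ {B B′ D σ} → D ∈ replace B B′ σ → D ≡ B′ ⊎ (D ∈ σ × D ≢ B)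
∈-replace⁻ {B} {B′} D∈ with ∈-map⁻ (replaceBlock B B′) D∈
... | E , E∈ , eq with E ≟ᴮ B
... | yes _ = inj₁ eq
... | no E≢B with refl ← eq = inj₂ (E∈ , E≢B)

∈-replace-new : ∀ {B σ} B′ → B ∈ σ → B′ ∈ replace B B′ σ
∈-replace-new {B} {σ} B′ B∈ = subst (_∈ replace B B′ σ) (replaceBlock-yes B B′) (∈-map⁺ (replaceBlock B B′) B∈)

∈-replace-old : ∀ {B B′ D σ} → D ∈ σ → D ≢ B → D ∈ replace B B′ σ
∈-replace-old {B} {B′} {D} {σ} D∈ D≢B =
  subst (_∈ replace B B′ σ) (replaceBlock-no D≢B) (∈-map⁺ (replaceBlock B B′) D∈)

replace-sorted : ∀ {B B′ σ} → hd B′ ≡ hd B → AllPairs _<ʰ_ σ → AllPairs _<ʰ_ (replace B B′ σ)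
replace-sorted eq s = AllPairsₚ.map⁺ (AllPairs.map (λ {D} {E} D<E →
  subst (_< _) (sym (hd-replaceBlock eq D)) (subst (hd D <_) (sym (hd-replaceBlock eq E)) D<E)) s)

-- τ arises from σ by cutting the consecutive pieces Cs out of the block B = P ++ concat Cs ++ Q,
-- which leaves P ++ Q; the edge label will be the last element of P.
record Cut (n : ℕ) (σ : Partition) (B P : Block) (Cs : List Block) (Q : Block) (τ : Partition) : Set where
  field
    cut-∈       : B ∈ σ
    cut-≡       : B ≡ P ++ concat Cs ++ Q
    outer-≢[]   : P ≢ []
    pieces-≢[]  : ∀ {C} → C ∈ Cs → C ≢ []
    isPartition : IsPartition n τ
    nonCrossing : NonCrossing τ
    length-cut  : length τ ≡ length Cs + length σ
    blocks      : ∀ {D} → D ∈ τ → (D ∈ σ × D ≢ B) ⊎ D ≡ P ++ Q ⊎ D ∈ Cs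
    kept        : ∀ {D} → D ∈ σ → D ≢ B → D ∈ τ
    outer       : P ++ Q ∈ τ
    pieces      : ∀ {C} → C ∈ Cs → C ∈ τ

module Split {n σ} (isσ : IsPartition n σ) (ncσ : NonCrossing σ) (P C Q : Block) (B∈ : P ++ C ++ Q ∈ σ)
  (P≢[] : P ≢ []) (C≢[] : C ≢ []) where

  private
    B B′ : Block
    B = P ++ C ++ Q
    B′ = P ++ Q

    B↑ : Increasing B
    B↑ = block-increasing isσ B∈
    B′↑ : Increasing B′
    B′↑ = AllPairs-omit P C B↑
    C↑ : Increasing C
    C↑ = AllPairs-++⁻ˡ C (AllPairs-++⁻ʳ P B↑)

    B′⊆B : B′ ⊆ B
    B′⊆B x∈ with ∈-++⁻ P x∈
    ... | inj₁ x∈P = ∈-++⁺ˡ x∈P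
    ... | inj₂ x∈Q = ∈-++⁺ʳ P (∈-++⁺ʳ C x∈Q)
    C⊆B : C ⊆ B
    C⊆B x∈ = ∈-++⁺ʳ P (∈-++⁺ˡ x∈)
    B⊆ : ∀ {x} → x ∈ B → x ∈ B′ ⊎ x ∈ C
    B⊆ x∈ with ∈-++⁻ P x∈
    ... | inj₁ x∈P = inj₁ (∈-++⁺ˡ x∈P)
    ... | inj₂ x∈CQ with ∈-++⁻ C x∈CQ
    ... | inj₁ x∈C = inj₂ x∈C
    ... | inj₂ x∈Q = inj₁ (∈-++⁺ʳ P x∈Q)

    side : ∀ {z} → z ∈ B′ → (∀ {x} → x ∈ C → z < x) ⊎ (∀ {x} → x ∈ C → x < z)
    side z∈ with ∈-++⁻ P z∈
    ... | inj₁ z∈P = inj₁ λ x∈ → AllPairs-++-cross P B↑ z∈P (∈-++⁺ˡ x∈)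
    ... | inj₂ z∈Q = inj₂ λ x∈ → AllPairs-++-cross C (AllPairs-++⁻ʳ P B↑) x∈ z∈Q

    disjoint : ∀ {x} → x ∈ B′ → x ∈ C → ⊥
    disjoint x∈B′ x∈C with side x∈B′
    ... | inj₁ less = <-irrefl refl (less x∈C)
    ... | inj₂ less = <-irrefl refl (less x∈C)

    contiguous : ∀ {x y z} → x ∈ C → y ∈ C → z ∈ B′ → x < z → z < y → ⊥
    contiguous x∈ y∈ z∈ x<z z<y with side z∈
    ... | inj₁ less = <-asym x<z (less x∈)
    ... | inj₂ less = <-asym z<y (less y∈)

  split : Partition
  split = insert C (replace B B′ σ)

  private
    data Kind (D : Block) : Set where
      old : D ∈ σ → D ≢ B → Kind D
      rest : D ≡ B′ → Kind D
      new : D ≡ C → Kind D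

    kind : ∀ {D} → D ∈ split → Kind D
    kind D∈ with ∈-insert⁻ (replace B B′ σ) D∈
    ... | inj₁ eq = new eq
    ... | inj₂ D∈r with ∈-replace⁻ D∈r
    ... | inj₁ eq = rest eq
    ... | inj₂ (D∈σ , D≢B) = old D∈σ D≢B

    kept-∈ : ∀ {D} → D ∈ σ → D ≢ B → D ∈ split
    kept-∈ D∈ D≢B = ∈-insert-old C (replace B B′ σ) (∈-replace-old D∈ D≢B)
    rest-∈ : B′ ∈ split
    rest-∈ = ∈-insert-old C (replace B B′ σ) (∈-replace-new B′ B∈)
    new-∈ : C ∈ split
    new-∈ = ∈-insert-new C (replace B B′ σ)

    B′≢[] : B′ ≢ []
    B′≢[] = ∈⇒≢[] (∈-++⁺ˡ {xs = P} (hd-∈ P≢[]))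

    fresh : ∀ {D} → D ∈ replace B B′ σ → hd C ≢ hd D
    fresh D∈ eq with ∈-replace⁻ D∈
    ... | inj₁ refl = disjoint (subst (_∈ B′) (sym eq) (hd-∈ B′≢[])) (hd-∈ C≢[])
    ... | inj₂ (D∈σ , D≢B) = D≢B (uniq isσ D∈σ B∈ (hd-∈ (block-≢[] isσ D∈σ)) (subst (_∈ B) eq (C⊆B (hd-∈ C≢[]))))

    blocks′ : ∀ {D} → Kind D → D ≢ [] × Increasing D
    blocks′ (old D∈ _) = block-≢[] isσ D∈ , block-increasing isσ D∈
    blocks′ (rest refl) = B′≢[] , B′↑
    blocks′ (new refl) = C≢[] , C↑

    range′ : ∀ {D i} → Kind D → i ∈ D → 1 ≤ i × i ≤ n
    range′ (old D∈ _) i∈ = range isσ D∈ i∈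
    range′ (rest refl) i∈ = range isσ B∈ (B′⊆B i∈)
    range′ (new refl) i∈ = range isσ B∈ (C⊆B i∈)

    cover′ : ∀ {i} → 1 ≤ i → i ≤ n → ∃ λ D → D ∈ split × i ∈ D
    cover′ a b with cover isσ a b
    ... | D , D∈ , i∈ with D ≟ᴮ B
    ... | no D≢B = D , kept-∈ D∈ D≢B , i∈
    ... | yes refl with B⊆ i∈
    ... | inj₁ i∈B′ = B′ , rest-∈ , i∈B′
    ... | inj₂ i∈C = C , new-∈ , i∈C

    uniq′ : ∀ {D E i} → Kind D → Kind E → i ∈ D → i ∈ E → D ≡ E
    uniq′ (old D∈ _) (old E∈ _) i∈ i∈′ = uniq isσ D∈ E∈ i∈ i∈′
    uniq′ (old D∈ D≢B) (rest refl) i∈ i∈′ = ⊥-elim (D≢B (uniq isσ D∈ B∈ i∈ (B′⊆B i∈′)))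
    uniq′ (old D∈ D≢B) (new refl) i∈ i∈′ = ⊥-elim (D≢B (uniq isσ D∈ B∈ i∈ (C⊆B i∈′)))
    uniq′ (rest refl) (old E∈ E≢B) i∈ i∈′ = ⊥-elim (E≢B (uniq isσ E∈ B∈ i∈′ (B′⊆B i∈)))
    uniq′ (rest refl) (rest refl) _ _ = refl
    uniq′ (rest refl) (new refl) i∈ i∈′ = ⊥-elim (disjoint i∈ i∈′)
    uniq′ (new refl) (old E∈ E≢B) i∈ i∈′ = ⊥-elim (E≢B (uniq isσ E∈ B∈ i∈′ (C⊆B i∈)))
    uniq′ (new refl) (rest refl) i∈ i∈′ = ⊥-elim (disjoint i∈′ i∈)
    uniq′ (new refl) (new refl) _ _ = refl

    -- The pair of P ++ Q and C does not cross because C is contiguous in the old block. Any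
    -- crossing with an untouched block would already be a crossing with the old block.
    uncrossed : ∀ {D E i j k l} → Kind D → Kind E → i < j → j < k → k < l → i ∈ D → k ∈ D → j ∈ E → l ∈ E → D ≡ E
    uncrossed (rest refl) (rest refl) _ _ _ _ _ _ _ = refl
    uncrossed (new refl) (new refl) _ _ _ _ _ _ _ = refl
    uncrossed (rest refl) (new refl) _ j<k k<l _ k∈ j∈ l∈ = ⊥-elim (contiguous j∈ l∈ k∈ j<k k<l)
    uncrossed (new refl) (rest refl) i<j j<k _ i∈ k∈ j∈ _ = ⊥-elim (contiguous i∈ k∈ j∈ i<j j<k)
    uncrossed (old D∈ _) (old E∈ _) a b c i∈ k∈ j∈ l∈ = nonCrossing-≤ isσ ncσ D∈ E∈ (<⇒≤ a) (<⇒≤ b) (<⇒≤ c) i∈ k∈ j∈ l∈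
    uncrossed (old D∈ D≢B) (rest refl) a b c i∈ k∈ j∈ l∈ =
      ⊥-elim (D≢B (nonCrossing-≤ isσ ncσ D∈ B∈ (<⇒≤ a) (<⇒≤ b) (<⇒≤ c) i∈ k∈ (B′⊆B j∈) (B′⊆B l∈)))
    uncrossed (old D∈ D≢B) (new refl) a b c i∈ k∈ j∈ l∈ =
      ⊥-elim (D≢B (nonCrossing-≤ isσ ncσ D∈ B∈ (<⇒≤ a) (<⇒≤ b) (<⇒≤ c) i∈ k∈ (C⊆B j∈) (C⊆B l∈)))
    uncrossed (rest refl) (old E∈ E≢B) a b c i∈ k∈ j∈ l∈ =
      ⊥-elim (E≢B (sym (nonCrossing-≤ isσ ncσ B∈ E∈ (<⇒≤ a) (<⇒≤ b) (<⇒≤ c) (B′⊆B i∈) (B′⊆B k∈) j∈ l∈)))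
    uncrossed (new refl) (old E∈ E≢B) a b c i∈ k∈ j∈ l∈ =
      ⊥-elim (E≢B (sym (nonCrossing-≤ isσ ncσ B∈ E∈ (<⇒≤ a) (<⇒≤ b) (<⇒≤ c) (C⊆B i∈) (C⊆B k∈) j∈ l∈)))

    hd-B′ : hd B′ ≡ hd B
    hd-B′ = trans (hd-++ P P≢[]) (sym (hd-++ P P≢[]))

  split-cut : Cut n σ B P (C ∷ []) Q split
  split-cut = record
    { cut-∈ = B∈
    ; cut-≡ = cong (λ z → P ++ z ++ Q) (sym (++-identityʳ C))
    ; outer-≢[] = P≢[]
    ; pieces-≢[] = λ where (here refl) → C≢[]
    ; isPartition = mkPartition (λ D∈ → blocks′ (kind D∈)) (insert-sorted (replace-sorted hd-B′ (heads isσ)) fresh)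
        (λ D∈ → range′ (kind D∈)) cover′ (λ D∈ E∈ → uniq′ (kind D∈) (kind E∈))
    ; nonCrossing = mkNonCrossing λ D∈ E∈ → uncrossed (kind D∈) (kind E∈)
    ; length-cut = trans (length-insert C (replace B B′ σ)) (cong suc (length-map (replaceBlock B B′) σ))
    ; blocks = λ D∈ → classify (kind D∈)
    ; kept = kept-∈
    ; outer = rest-∈
    ; pieces = λ where (here refl) → new-∈
    }
    where
    classify : ∀ {D} → Kind D → (D ∈ σ × D ≢ B) ⊎ D ≡ B′ ⊎ D ∈ C ∷ []
    classify (old D∈ D≢B) = inj₁ (D∈ , D≢B)
    classify (rest eq) = inj₂ (inj₁ eq)
    classify (new eq) = inj₂ (inj₂ (here eq))

-- Pieces leave one by one from the left: once C is cut out, the remaining pieces are cut from P ++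
-- R with the same P.
cut : ∀ {n σ B} P Cs Q → IsPartition n σ → NonCrossing σ → B ∈ σ → B ≡ P ++ concat Cs ++ Q → P ≢ [] →
  (∀ {C} → C ∈ Cs → C ≢ []) → ∃ (Cut n σ B P Cs Q)
cut {n} {σ} {B} P [] Q isσ ncσ B∈ refl P≢[] _ = σ , record
  { cut-∈ = B∈ ; cut-≡ = refl ; outer-≢[] = P≢[] ; pieces-≢[] = λ () ; isPartition = isσ ; nonCrossing = ncσ
  ; length-cut = refl ; blocks = classify ; kept = λ D∈ _ → D∈ ; outer = B∈ ; pieces = λ () }
  where
  classify : ∀ {D} → D ∈ σ → (D ∈ σ × D ≢ B) ⊎ D ≡ B ⊎ D ∈ []
  classify {D} D∈ with D ≟ᴮ B
  ... | yes eq = inj₂ (inj₁ eq)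
  ... | no D≢B = inj₁ (D∈ , D≢B)
cut {n} {σ} P (C ∷ Cs) Q isσ ncσ B∈ refl P≢[] Cs≢[] =
  proj₁ second , record
  { cut-∈ = B∈ ; cut-≡ = refl ; outer-≢[] = P≢[] ; pieces-≢[] = Cs≢[]
  ; isPartition = Cut.isPartition c₂ ; nonCrossing = Cut.nonCrossing c₂
  ; length-cut = trans (Cut.length-cut c₂) (trans (cong (length Cs +_) (Cut.length-cut c₁)) (+-suc (length Cs) (length σ)))
  ; blocks = λ D∈ → classify (Cut.blocks c₂ D∈)
  ; kept = λ D∈ D≢B → Cut.kept c₂ (Cut.kept c₁ D∈ (λ eq → D≢B (trans eq (sym assoc)))) (λ { refl → D≢B (uniq isσ D∈ B∈ p∈PR (∈-++⁺ˡ (hd-∈ P≢[]))) })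
  ; outer = Cut.outer c₂
  ; pieces = λ where
      (here refl) → Cut.kept c₂ (Cut.pieces c₁ (here refl)) C≢PR
      (there D∈) → Cut.pieces c₂ D∈ }
  where
  R : Block
  R = concat Cs ++ Q
  assoc : P ++ (C ++ concat Cs) ++ Q ≡ P ++ C ++ R
  assoc = cong (P ++_) (++-assoc C (concat Cs) Q)
  B∈′ : P ++ C ++ R ∈ σ
  B∈′ = subst (_∈ σ) assoc B∈
  p∈PR : hd P ∈ P ++ R
  p∈PR = ∈-++⁺ˡ (hd-∈ P≢[])
  module S = Split isσ ncσ P C R B∈′ P≢[] (Cs≢[] (here refl))
  c₁ : Cut n σ (P ++ C ++ R) P (C ∷ []) R S.split
  c₁ = S.split-cut
  second : ∃ (Cut n S.split (P ++ R) P Cs Q)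
  second = cut P Cs Q (Cut.isPartition c₁) (Cut.nonCrossing c₁) (Cut.outer c₁) refl P≢[] (Cs≢[] ∘ there)
  c₂ : Cut n S.split (P ++ R) P Cs Q (proj₁ second)
  c₂ = proj₂ second
  C≢PR : C ≢ P ++ R
  C≢PR eq = <-irrefl refl (AllPairs-++-cross P (block-increasing isσ B∈′) (hd-∈ P≢[])
    (∈-++⁺ˡ (subst (hd P ∈_) (sym eq) p∈PR)))
  classify : ∀ {D} → (D ∈ S.split × D ≢ P ++ R) ⊎ D ≡ P ++ Q ⊎ D ∈ Cs →
    (D ∈ σ × D ≢ P ++ (C ++ concat Cs) ++ Q) ⊎ D ≡ P ++ Q ⊎ D ∈ C ∷ Cs
  classify (inj₂ (inj₁ eq)) = inj₂ (inj₁ eq)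
  classify (inj₂ (inj₂ D∈)) = inj₂ (inj₂ (there D∈))
  classify (inj₁ (D∈ , D≢PR)) with Cut.blocks c₁ D∈
  ... | inj₁ (D∈σ , D≢B) = inj₁ (D∈σ , λ eq → D≢B (trans eq assoc))
  ... | inj₂ (inj₁ eq) = ⊥-elim (D≢PR eq)
  ... | inj₂ (inj₂ (here eq)) = inj₂ (inj₂ (here eq))

module CutFacts {n σ B P Cs Q τ} (isσ : IsPartition n σ) (c : Cut n σ B P Cs Q τ) where

  open Cut c

  whole : Block
  whole = P ++ concat Cs ++ Q

  whole-∈ : whole ∈ σ
  whole-∈ = subst (_∈ σ) cut-≡ cut-∈

  whole-increasing : Increasing whole
  whole-increasing = block-increasing isσ whole-∈

  outer⊆whole : P ++ Q ⊆ whole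
  outer⊆whole x∈ with ∈-++⁻ P x∈
  ... | inj₁ x∈P = ∈-++⁺ˡ x∈P
  ... | inj₂ x∈Q = ∈-++⁺ʳ P (∈-++⁺ʳ (concat Cs) x∈Q)

  piece⊆whole : ∀ {C} → C ∈ Cs → C ⊆ whole
  piece⊆whole C∈ x∈ = ∈-++⁺ʳ P (∈-++⁺ˡ (∈-concat⁺′ x∈ C∈))

  whole⊆ : ∀ {x} → x ∈ whole → x ∈ P ++ Q ⊎ ∃ λ C → x ∈ C × C ∈ Cs
  whole⊆ x∈ with ∈-++⁻ P x∈
  ... | inj₁ x∈P = inj₁ (∈-++⁺ˡ x∈P)
  ... | inj₂ x∈R with ∈-++⁻ (concat Cs) x∈R
  ... | inj₁ x∈Cs = inj₂ (∈-concat⁻′ Cs x∈Cs)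
  ... | inj₂ x∈Q = inj₁ (∈-++⁺ʳ P x∈Q)

  before<piece : ∀ {C x y} → x ∈ P → C ∈ Cs → y ∈ C → x < y
  before<piece x∈ C∈ y∈ = AllPairs-++-cross P whole-increasing x∈ (∈-++⁺ˡ (∈-concat⁺′ y∈ C∈))

  piece<after : ∀ {C x y} → C ∈ Cs → x ∈ C → y ∈ Q → x < y
  piece<after C∈ x∈ y∈ =
    AllPairs-++-cross (concat Cs) (AllPairs-++⁻ʳ P whole-increasing) (∈-concat⁺′ x∈ C∈) y∈

  first∈ : hd P ∈ P ++ Q
  first∈ = ∈-++⁺ˡ (hd-∈ outer-≢[])

  cut-refines : Refines τ σ
  cut-refines D D∈ with blocks D∈
  ... | inj₁ (D∈σ , _) = D , D∈σ , id
  ... | inj₂ (inj₁ refl) = whole , whole-∈ , outer⊆whole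
  ... | inj₂ (inj₂ D∈Cs) = whole , whole-∈ , piece⊆whole D∈Cs

  piece-∉ : ∀ {C} → C ∈ Cs → C ∉ σ
  piece-∉ C∈ C∈σ = <-irrefl refl (before<piece (hd-∈ outer-≢[]) C∈
    (subst (hd P ∈_) (sym (uniq isσ C∈σ whole-∈ (hd-∈ (pieces-≢[] C∈)) (piece⊆whole C∈ (hd-∈ (pieces-≢[] C∈))))) (outer⊆whole first∈)))

  outer≢piece : ∀ {C} → C ∈ Cs → P ++ Q ≢ C
  outer≢piece C∈ eq = <-irrefl refl (before<piece (hd-∈ outer-≢[]) C∈ (subst (hd P ∈_) eq first∈))

  outer-∉ : ∀ {C} → C ∈ Cs → P ++ Q ∉ σ
  outer-∉ {C} C∈ O∈σ = outer≢piece C∈ (uniq isPartition outer (pieces C∈)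
    (subst (hd C ∈_) (sym (uniq isσ O∈σ whole-∈ first∈ (outer⊆whole first∈))) (piece⊆whole C∈ h∈)) h∈)
    where
    h∈ : hd C ∈ C
    h∈ = hd-∈ (pieces-≢[] C∈)

-- The edge label of a cut

eqListᵇ-sound : ∀ xs ys → T (eqListᵇ xs ys) → xs ≡ ys
eqListᵇ-sound [] [] _ = refl
eqListᵇ-sound (x ∷ xs) (y ∷ ys) t with x ≡ᵇ y in eq
... | true = cong₂ _∷_ (≡ᵇ⇒≡ x y (subst T (sym eq) tt)) (eqListᵇ-sound xs ys t)

eqListᵇ-refl : ∀ xs → T (eqListᵇ xs xs)
eqListᵇ-refl [] = tt
eqListᵇ-refl (x ∷ xs) with x ≡ᵇ x in eq
... | true = eqListᵇ-refl xs
... | false = subst T eq (≡⇒≡ᵇ x x refl)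

blockOfᵇ-sound : ∀ {B} σ → T (blockOfᵇ B σ) → B ∈ σ
blockOfᵇ-sound {B} σ t = Any.map (λ {C} → eqListᵇ-sound B C) (Anyₚ.any⁻ (eqListᵇ B) σ t)

blockOfᵇ-complete : ∀ {B σ} → B ∈ σ → T (blockOfᵇ B σ)
blockOfᵇ-complete {B} B∈ = Anyₚ.any⁺ (eqListᵇ B) (Any.map (λ { refl → eqListᵇ-refl B }) B∈)

T-not⁺ : ∀ {b} → ¬ T b → T (not b)
T-not⁺ {true} ¬t = ¬t tt
T-not⁺ {false} _ = tt

T-not⁻ : ∀ {b} → T (not b) → ¬ T b
T-not⁻ {false} _ ()

∈-merged⁺ : ∀ {π σ D} → D ∈ π → D ∉ σ → D ∈ merged π σ
∈-merged⁺ {σ = σ} D∈ D∉ = ∈-filter⁺ (λ B → T? (not (blockOfᵇ B σ))) D∈ (T-not⁺ (D∉ ∘ blockOfᵇ-sound σ))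

∈-merged⁻ : ∀ {π σ D} → D ∈ merged π σ → D ∈ π × D ∉ σ
∈-merged⁻ {π} {σ} D∈ with D∈π , t ← ∈-filter⁻ (λ B → T? (not (blockOfᵇ B σ))) {xs = π} D∈ =
  D∈π , λ D∈σ → T-not⁻ t (blockOfᵇ-complete D∈σ)

merged-sorted : ∀ {n π} σ → IsPartition n π → AllPairs _<ʰ_ (merged π σ)
merged-sorted σ isπ = AllPairsₚ.filter⁺ (λ B → T? (not (blockOfᵇ B σ))) (heads isπ)

maxList-upper : ∀ {L x} → All (_≤ x) L → maxList L ≤ x
maxList-upper [] = z≤n
maxList-upper (y≤x ∷ ps) = ⊔-lub y≤x (maxList-upper ps)

≤-maxList : ∀ {L x} → x ∈ L → x ≤ maxList L
≤-maxList {y ∷ L} (here refl) = m≤m⊔n y (maxList L)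
≤-maxList {y ∷ L} (there x∈) = ≤-trans (≤-maxList x∈) (m≤n⊔m y (maxList L))

-- `labelFrom` inspects only the first two merged blocks, so the two blocks with the smallest minima
-- are all that has to be identified.
sorted-first-two : ∀ {M X Y} → AllPairs _<ʰ_ M → X ∈ M → Y ∈ M → X <ʰ Y →
  (∀ {Z} → Z ∈ M → Z ≡ X ⊎ Z ≡ Y ⊎ Y <ʰ Z) → ∃ λ rest → M ≡ X ∷ Y ∷ rest
sorted-first-two {Z ∷ M} (Z< ∷ sM) X∈ Y∈ X<Y only with X∈ | only (here refl)
... | there X∈M | inj₁ refl = ⊥-elim (<-irrefl refl (All.lookup Z< X∈M))
... | there X∈M | inj₂ (inj₁ refl) = ⊥-elim (<-asym X<Y (All.lookup Z< X∈M))
... | there X∈M | inj₂ (inj₂ Y<Z) = ⊥-elim (<-asym X<Y (<-trans Y<Z (All.lookup Z< X∈M)))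
... | here refl | _ = second Y∈ X<Y Z< sM (only ∘ there)
  where
  second : ∀ {X Y M} → Y ∈ X ∷ M → X <ʰ Y → All (X <ʰ_) M → AllPairs _<ʰ_ M →
    (∀ {Z} → Z ∈ M → Z ≡ X ⊎ Z ≡ Y ⊎ Y <ʰ Z) → ∃ λ rest → X ∷ M ≡ X ∷ Y ∷ rest
  second (here refl) X<Y _ _ _ = ⊥-elim (<-irrefl refl X<Y)
  second {M = W ∷ M} (there Y∈) X<Y (X<W ∷ _) (W< ∷ _) only with only (here refl)
  ... | inj₁ refl = ⊥-elim (<-irrefl refl X<W)
  ... | inj₂ (inj₁ refl) = M , refl
  ... | inj₂ (inj₂ Y<W) with Y∈
  ... | here refl = ⊥-elim (<-irrefl refl Y<W)
  ... | there Y∈M = ⊥-elim (<-asym Y<W (All.lookup W< Y∈M))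

-- The merged blocks are P ++ Q and the pieces, and the two with the smallest minima are P ++ Q and
-- C. The elements of P ++ Q below `hd C` are exactly those of P.
label-cut : ∀ {n σ B P C Cs Q τ} → IsPartition n σ → Cut n σ B P (C ∷ Cs) Q τ → label τ σ ≡ lst P
label-cut {n} {σ} {B} {P} {C} {Cs} {Q} {τ} isσ c =
  trans (cong labelFrom (proj₂ first-two)) (≤-antisym (maxList-upper (All.tabulate upper)) (≤-maxList p∈))
  where
  open CutFacts isσ c
  open Cut c
  C≢[] : C ≢ []
  C≢[] = pieces-≢[] (here refl)
  only : ∀ {D} → D ∈ merged τ σ → D ≡ P ++ Q ⊎ D ≡ C ⊎ C <ʰ D
  only D∈ with D∈τ , D∉σ ← ∈-merged⁻ {τ} {σ} D∈ with blocks D∈τ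
  ... | inj₁ (D∈σ , _) = ⊥-elim (D∉σ D∈σ)
  ... | inj₂ (inj₁ eq) = inj₁ eq
  ... | inj₂ (inj₂ (here eq)) = inj₂ (inj₁ eq)
  ... | inj₂ (inj₂ (there D∈Cs)) = inj₂ (inj₂ (AllPairs-++-cross C
          (AllPairs-++⁻ˡ (C ++ concat Cs) (AllPairs-++⁻ʳ P whole-increasing))
          (hd-∈ C≢[]) (∈-concat⁺′ (hd-∈ (pieces-≢[] (there D∈Cs))) D∈Cs)))
  O<C : (P ++ Q) <ʰ C
  O<C = subst (_< hd C) (sym (hd-++ P outer-≢[])) (before<piece (hd-∈ outer-≢[]) (here refl) (hd-∈ C≢[]))
  first-two : ∃ λ rest → merged τ σ ≡ (P ++ Q) ∷ C ∷ rest
  first-two = sorted-first-two (merged-sorted σ isPartition) (∈-merged⁺ outer (outer-∉ (here refl)))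
    (∈-merged⁺ (pieces (here refl)) (piece-∉ (here refl))) O<C only
  below? : ∀ i → Dec (T (i <ᵇ hd C))
  below? i = T? (i <ᵇ hd C)
  p∈ : lst P ∈ filter below? (P ++ Q)
  p∈ = ∈-filter⁺ below? (∈-++⁺ˡ (lst-∈ outer-≢[])) (<⇒<ᵇ (before<piece (lst-∈ outer-≢[]) (here refl) (hd-∈ C≢[])))
  upper : ∀ {i} → i ∈ filter below? (P ++ Q) → i ≤ lst P
  upper {i} i∈ with i∈O , t ← ∈-filter⁻ below? {xs = P ++ Q} i∈ with ∈-++⁻ P i∈O
  ... | inj₁ i∈P = ≤-lst (AllPairs-++⁻ˡ P whole-increasing) i∈P
  ... | inj₂ i∈Q = ⊥-elim (<-asym (<ᵇ⇒< i (hd C) t) (piece<after (here refl) (hd-∈ C≢[]) i∈Q))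

-- Subdividing an increasing list at chosen elements

∈-between : ∀ {A : Set} {R : A → A → Set} (X : List A) {f Y g} → (∀ {x} → ¬ R x x) → (∀ {x y} → R x y → ¬ R y x) →
  AllPairs R (X ++ f ∷ Y) → g ∈ X ++ f ∷ Y → R f g → g ∈ Y
∈-between X irrefl asym s g∈ fRg with ∈-++⁻ X g∈
... | inj₁ g∈X = ⊥-elim (asym fRg (AllPairs-++-cross X s g∈X (here refl)))
... | inj₂ (here refl) = ⊥-elim (irrefl fRg)
... | inj₂ (there g∈Y) = g∈Y

chunks : ∀ {fs} R → Increasing R → Increasing fs → fs ⊆ R →
  ∃ λ Cs → ∃ λ Q → R ≡ concat Cs ++ Q × map lst Cs ≡ fs × (∀ {C} → C ∈ Cs → C ≢ [])
chunks {[]} R _ _ _ = [] , R , refl , refl , λ ()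
chunks {f ∷ fs} R R↑ (f< ∷ fs↑) sub with X , Y , refl ← ∈-∃++ (sub (here refl))
  with Cs , Q , refl , refl , ne ← chunks Y (AllPairs.tail (AllPairs-++⁻ʳ X R↑)) fs↑
         (λ g∈ → ∈-between X (<-irrefl refl) <-asym R↑ (sub (there g∈)) (All.lookup f< g∈)) =
  X ∷ʳ f ∷ Cs , Q ,
  trans (sym (++-assoc X (f ∷ []) (concat Cs ++ Q))) (sym (++-assoc (X ∷ʳ f) (concat Cs) Q)) ,
  cong (_∷ map lst Cs) (lst-∷ʳ X f) ,
  λ where
    (here refl) → ∈⇒≢[] (∈-++⁺ʳ X (here refl))
    (there C∈) → ne C∈

-- When `lst P` and the last elements of the pieces come from one face, this encloses every piece
-- between two elements of that face: one just before it and one at its end.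
chunk-between : ∀ P Cs Q {C} → P ≢ [] → (∀ {D} → D ∈ Cs → D ≢ []) → C ∈ Cs →
  ∃ λ X → ∃ λ Y → P ++ concat Cs ++ Q ≡ X ++ C ++ Y × X ≢ [] × (lst X ∈ lst P ∷ map lst Cs)
chunk-between P (C ∷ Cs) Q P≢[] _ (here refl) =
  P , concat Cs ++ Q , cong (P ++_) (++-assoc C (concat Cs) Q) , P≢[] , here refl
chunk-between P (D ∷ Cs) Q {C} P≢[] ne (there C∈)
  with X , Y , eq , X≢[] , f∈ ← chunk-between (P ++ D) Cs Q (∈⇒≢[] (∈-++⁺ˡ {ys = D} (hd-∈ P≢[]))) (ne ∘ there) C∈ =
  X , Y , trans (cong (P ++_) (++-assoc D (concat Cs) Q)) (trans (sym (++-assoc P D (concat Cs ++ Q))) eq) , X≢[] ,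
  there (subst (λ z → lst X ∈ z ∷ map lst Cs) (lst-++ P (ne (here refl))) f∈)

leaving : ∀ {z zs C} → Increasing (z ∷ zs) → z ∈ C → Any (_∉ C) zs → ∃ λ p → ∃ λ x → Consec (z ∷ zs) p x × p ∈ C × x ∉ C
leaving {z} {y ∷ _} {C} inc@(z< ∷ inc′) z∈ out with y ∈? C
... | no y∉ = z , y , Consec-here inc , z∈ , y∉
leaving {C = C} inc@(z< ∷ inc′) z∈ (here y∉) | yes y∈ = ⊥-elim (y∉ y∈)
leaving {C = C} inc@(z< ∷ inc′) z∈ (there out) | yes y∈ with p , x , con , p∈ , x∉ ← leaving inc′ y∈ out =
  p , x , Consec-there z< con , p∈ , x∉

two-elements : ∀ {L : List ℕ} {a b} → a ≢ b → a ∈ L → b ∈ L → ∃ λ x → ∃ λ y → ∃ λ r → L ≡ x ∷ y ∷ r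
two-elements {x ∷ y ∷ r} _ _ _ = x , y , r , refl
two-elements {_ ∷ []} a≢b (here refl) (here refl) = ⊥-elim (a≢b refl)

-- Cover relations are cuts into d + 1 pieces

module Covering (d m : ℕ) .{{_ : NonZero d}} (size-≋ : Modular._≋_ d (suc m) 1) where

  open Modular d
  open Criterion d m size-≋ public

  private
    n : ℕ
    n = suc m

    d≋0 : d ≋ 0
    d≋0 = congruent 0 1 refl

  length-concat : ∀ (Cs : List Block) → (∀ {C} → C ∈ Cs → length C ≋ 1) → length (concat Cs) ≋ length Cs
  length-concat [] _ = ≋-refl
  length-concat (C ∷ Cs) sizes =
    ≋-trans (≋-reflexive (length-++ C)) (≋-+ (sizes (here refl)) (length-concat Cs (sizes ∘ there)))

  AP-concat : ∀ {a} Cs {C} → AP a (concat Cs) → C ∈ Cs → C ≢ [] → AP (hd C) C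
  AP-concat (C ∷ Cs) ap (here refl) ne = AP-cong (≋-sym (AP-hd ne (AP-++⁻ˡ C ap))) (AP-++⁻ˡ C ap)
  AP-concat (C ∷ Cs) ap (there C∈) ne = AP-concat Cs (AP-++⁻ʳ C ap) C∈ ne

  -- The first piece starts at an element ≡ a and ends at one ≡ a, so its size is ≡ 1. Hence the
  -- next piece starts at an element ≡ a + 1, which is also the residue of the next prescribed end.
  chunk-sizes : ∀ {a} Cs Q → AP a (concat Cs ++ Q) → AP a (map lst Cs) → (∀ {C} → C ∈ Cs → C ≢ []) →
    ∀ {C} → C ∈ Cs → length C ≋ 1
  chunk-sizes {a} (C ∷ Cs) Q ap (l ∷ ls) ne C∈ = result C∈
    where
    ap′ : AP a (C ++ concat Cs ++ Q)
    ap′ = subst (AP a) (++-assoc C (concat Cs) Q) ap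
    size-C : length C ≋ 1
    size-C = lst≋⇒size (ne (here refl)) (AP-++⁻ˡ C ap′) l
    result : ∀ {D} → D ∈ C ∷ Cs → length D ≋ 1
    result (here refl) = size-C
    result (there D∈) = chunk-sizes Cs Q
      (AP-cong (≋-trans (≋-+ (≋-refl {a}) size-C) (≋-reflexive (+-comm a 1))) (AP-++⁻ʳ C ap′)) ls (ne ∘ there) D∈

  record GoodCut (σ : Partition) (B P : Block) (Cs : List Block) (Q : Block) (τ : Partition) : Set where
    field
      isCut : Cut n σ B P Cs Q τ
      count : length Cs ≡ d
      sizes : ∀ {C} → C ∈ Cs → length C ≋ 1

  module _ {σ B P Cs Q τ} (goodσ : Good n σ) (c : GoodCut σ B P Cs Q τ) where

    open GoodCut c
    open Cut isCut
    open CutFacts (Good.isPartition goodσ) isCut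

    private
      goodB : GoodBlock whole
      goodB = Good.goodBlocks goodσ whole-∈

      length-pieces : length (concat Cs) ≋ 0
      length-pieces = ≋-trans (length-concat Cs sizes) (≋-trans (≋-reflexive count) d≋0)

      ap-R : AP (hd whole + length P) (concat Cs ++ Q)
      ap-R = AP-++⁻ʳ P (progression goodB)

      good-outer : GoodBlock (P ++ Q)
      good-outer = goodBlock
        (AP-cong (≋-reflexive (trans (hd-++ P outer-≢[]) (sym (hd-++ P outer-≢[]))))
          (AP-++⁺ (AP-++⁻ˡ P (progression goodB))
            (AP-cong (≋-trans (≋-+ ≋-refl length-pieces) (≋-reflexive (+-identityʳ _))) (AP-++⁻ʳ (concat Cs) ap-R))))
        (≋-trans (≋-reflexive (length-++ P)) (≋-trans
          (≋-+ (≋-refl {length P}) (≋-trans (≋-+ (≋-sym length-pieces) ≋-refl) (≋-reflexive (sym (length-++ (concat Cs))))))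
          (≋-trans (≋-reflexive (sym (length-++ P))) (size goodB))))

      good-piece : ∀ {C} → C ∈ Cs → GoodBlock C
      good-piece C∈ = goodBlock (AP-concat Cs (AP-++⁻ˡ (concat Cs) ap-R) C∈ (pieces-≢[] C∈)) (sizes C∈)

      good-block : ∀ {D} → (D ∈ σ × D ≢ B) ⊎ D ≡ P ++ Q ⊎ D ∈ Cs → GoodBlock D
      good-block (inj₁ (D∈ , _)) = Good.goodBlocks goodσ D∈
      good-block (inj₂ (inj₁ refl)) = good-outer
      good-block (inj₂ (inj₂ D∈)) = good-piece D∈

    -- The pieces have total length ≡ d ≡ 0, so removing them changes neither the residues expected
    -- in Q nor the size of the outer block modulo d.
    goodCut-good : Good n τ
    goodCut-good = good isPartition nonCrossing (λ D∈ → good-block (blocks D∈))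

    goodCut-length : length τ ≡ d + length σ
    goodCut-length = trans length-cut (cong (_+ length σ) count)

    goodCut-≢ : τ ≢ σ
    goodCut-≢ refl = m+1+n≢n′ goodCut-length
      where
      m+1+n≢n′ : ∀ {l} → l ≢ d + l
      m+1+n≢n′ eq = <-irrefl eq (m<n+m _ (n≢0⇒n>0 (≢-nonZero⁻¹ d)))

  module FindCut {π σ} (goodπ : Good n π) (goodσ : Good n σ) (π≤σ : Refines π σ) where

    open Good goodπ renaming (isPartition to isπ; nonCrossing to ncπ; goodBlocks to goodBlocksπ)
    open Good goodσ renaming (isPartition to isσ; nonCrossing to ncσ; goodBlocks to goodBlocksσ)
    open Separation π

    -- `find-cut` produces such a cut for every π strictly below σ. If σ covers π, then minimality
    -- leaves only τ ≡ π, because a cut differs from σ.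
    Found : Set
    Found = ∃ λ B → ∃ λ P → ∃ λ Cs → ∃ λ Q → ∃ λ τ → GoodCut σ B P Cs Q τ × Refines π τ

    missing-block : π ≢ σ → ∃ λ B → B ∈ σ × B ∉ π
    missing-block π≢σ with All.all? (_∈ᴮ? π) σ
    ... | yes all = ⊥-elim (π≢σ (refines-antisym isπ isσ π≤σ λ B B∈ → B , All.lookup all B∈ , id))
    ... | no ¬all = find (Allₚ.¬All⇒Any¬ (_∈ᴮ? π) σ ¬all)

    module InBlock {B} (B∈ : B ∈ σ) where

      open Face isπ ncπ isσ ncσ π≤σ B∈

      B↑ : Increasing B
      B↑ = block-increasing isσ B∈

      break : B ∉ π → ∃ λ C → ∃ λ p → ∃ λ x → C ∈ π × Consec B p x × p ∈ C × x ∉ C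
      break B∉ = within (block-of (hd-∈ (block-≢[] isσ B∈)))
        where
        tail-of : ∀ {L C} → L ≢ [] → Increasing L → hd L ∈ C → Any (_∉ C) L →
          ∃ λ p → ∃ λ x → Consec L p x × p ∈ C × x ∉ C
        tail-of {[]} ne _ _ _ = ⊥-elim (ne refl)
        tail-of {_ ∷ _} _ inc h∈ (here h∉) = ⊥-elim (h∉ h∈)
        tail-of {_ ∷ _} _ inc h∈ (there out) = leaving inc h∈ out
        within : (∃ λ C → C ∈ π × hd B ∈ C × C ⊆ B) → ∃ λ C → ∃ λ p → ∃ λ x → C ∈ π × Consec B p x × p ∈ C × x ∉ C
        within (C , C∈ , h∈ , C⊆B) with All.all? (_∈? C) B
        ... | yes all = ⊥-elim (B∉ (subst (_∈ π) (increasing-ext (block-increasing isπ C∈) B↑ C⊆B (All.lookup all)) C∈))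
        ... | no ¬all with p , x , con , p∈ , x∉ ← tail-of (block-≢[] isσ B∈) B↑ h∈ (Allₚ.¬All⇒Any¬ (_∈? C) B ¬all) =
          C , p , x , C∈ , con , p∈ , x∉

      -- The witness is the cyclic predecessor of x in its block D. It is not p: either it is
      -- `lst D` ≥ x > p, or it lies in D, which differs from the block C of p because x ∉ C.
      second-in-face : ∀ {C p x} → C ∈ π → Consec B p x → p ∈ C → x ∉ C → ∃ λ g → p ≢ g × g ∈ face p
      second-in-face {C} {p} {x} C∈ con p∈ x∉ = from-block (block-of (Consec.right con))
        where
        p∈face : p ∈ face p
        p∈face = ∈-face⁺ (Consec.left con) ∼-refl
        from-block : (∃ λ D → D ∈ π × x ∈ D × D ⊆ B) → ∃ λ g → p ≢ g × g ∈ face p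
        from-block (D , D∈ , x∈ , D⊆B) = from-prev (prev (block-increasing isπ D∈) x∈)
          where
          from-prev : x ≡ hd D ⊎ ∃ (λ q → Consec D q x) → ∃ λ g → p ≢ g × g ∈ face p
          from-prev (inj₁ refl) = lst D ,
            (λ eq → <⇒≱ (Consec.less con) (subst (hd D ≤_) (sym eq) (≤-lst (block-increasing isπ D∈) x∈))) ,
            face-extend p∈face (D⊆B (lst-∈ (block-≢[] isπ D∈))) (before-block-∼ D∈ con)
          from-prev (inj₂ (q , conD)) = q ,
            (λ eq → x∉ (subst (x ∈_) (uniq isπ D∈ C∈ (subst (_∈ D) (sym eq) (Consec.left conD)) p∈) x∈)) ,
            face-extend p∈face (D⊆B (Consec.left conD)) (∼-sym (within-block-∼ D∈ D⊆B con conD))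

      -- A block D of π that meets a piece stays inside it. The marker just before the piece and the
      -- one at its end are ∼, while an element of D outside the piece would give a chord over
      -- exactly one of them.
      refines-cut : ∀ {p P Cs Q τ} → Cut n σ B P Cs Q τ → lst P ∈ face p → (∀ {g} → g ∈ map lst Cs → g ∈ face p) → Refines π τ
      refines-cut {p} {P} {Cs} {Q} {τ} c f∈ gs∈ D D∈ = result (π≤σ D D∈)
        where
        open Cut c
        open CutFacts isσ c
        stays-in-piece : ∀ {C z y} → C ∈ Cs → z ∈ D → y ∈ D → z ∈ C → y ∈ whole → y ∈ C
        stays-in-piece {C} {z} {y} C∈ z∈D y∈D z∈C y∈ = located (chunk-between P Cs Q outer-≢[] pieces-≢[] C∈)
          where
          g : ℕ
          g = lst C
          located : (∃ λ X → ∃ λ Y → P ++ concat Cs ++ Q ≡ X ++ C ++ Y × X ≢ [] × (lst X ∈ lst P ∷ map lst Cs)) → y ∈ C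
          located (X , Y , eq , X≢[] , f∈′) = side (∈-++⁻ X (subst (y ∈_) eq y∈))
            where
            XCY↑ : Increasing (X ++ C ++ Y)
            XCY↑ = subst Increasing eq whole-increasing
            C↑ : Increasing C
            C↑ = AllPairs-++⁻ˡ C (AllPairs-++⁻ʳ X XCY↑)
            f-face : lst X ∈ face p
            f-face = in-face f∈′
              where
              in-face : ∀ {w} → w ∈ lst P ∷ map lst Cs → w ∈ face p
              in-face (here refl) = f∈
              in-face (there w∈) = gs∈ w∈
            f∼g : lst X ∼ g
            f∼g = face-∼ f-face (gs∈ (∈-map⁺ lst C∈))
            f<z : lst X < z
            f<z = AllPairs-++-cross X XCY↑ (lst-∈ X≢[]) (∈-++⁺ˡ z∈C)
            z≤g : z ≤ g
            z≤g = ≤-lst C↑ z∈C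
            side : y ∈ X ⊎ y ∈ C ++ Y → y ∈ C
            side (inj₁ y∈X) = ⊥-elim (<⇒≱
              (proj₂ (apply (proj₁ f∼g) D∈ y∈D z∈D (≤-lst (AllPairs-++⁻ˡ X XCY↑) y∈X) f<z)) z≤g)
            side (inj₂ y∈CY) = side′ (∈-++⁻ C y∈CY)
              where
              side′ : y ∈ C ⊎ y ∈ Y → y ∈ C
              side′ (inj₁ y∈C) = y∈C
              side′ (inj₂ y∈Y) = ⊥-elim (<⇒≱ f<z (proj₁ (apply (proj₂ f∼g) D∈ z∈D y∈D z≤g
                (AllPairs-++-cross C (AllPairs-++⁻ʳ X XCY↑) (lst-∈ (pieces-≢[] C∈)) y∈Y))))
        h∈ : hd D ∈ D
        h∈ = hd-∈ (block-≢[] isπ D∈)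
        inside : D ⊆ whole → (hd D ∈ P ++ Q ⊎ ∃ λ C → hd D ∈ C × C ∈ Cs) → ∃ λ E → E ∈ τ × D ⊆ E
        inside D⊆ (inj₂ (C , h∈C , C∈)) = C , pieces C∈ , λ y∈ → stays-in-piece C∈ h∈ y∈ h∈C (D⊆ y∈)
        inside D⊆ (inj₁ h∈O) = P ++ Q , outer , λ y∈ → outer-side y∈ (whole⊆ (D⊆ y∈))
          where
          outer-side : ∀ {y} → y ∈ D → (y ∈ P ++ Q ⊎ ∃ λ C → y ∈ C × C ∈ Cs) → y ∈ P ++ Q
          outer-side y∈ (inj₁ y∈O) = y∈O
          outer-side y∈ (inj₂ (C , y∈C , C∈)) = ⊥-elim (outer≢piece C∈
            (uniq isPartition outer (pieces C∈) h∈O (stays-in-piece C∈ y∈ h∈ y∈C (D⊆ h∈))))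
        result : (∃ λ E → E ∈ σ × D ⊆ E) → ∃ λ E → E ∈ τ × D ⊆ E
        result (E , E∈ , D⊆E) with E ≟ᴮ B
        ... | no E≢B = E , kept E∈ E≢B , D⊆E
        ... | yes refl = inside D⊆whole (whole⊆ (D⊆whole h∈))
          where
          D⊆whole : D ⊆ whole
          D⊆whole {y} y∈ = subst (y ∈_) cut-≡ (D⊆E y∈)

      -- The first d + 1 elements of a face delimit d pieces of size ≡ 1.
      cut-face : ∀ {p f₁ f₂ r} → p ∈ B → face p ≡ f₁ ∷ f₂ ∷ r → Found
      cut-face {p} {f₁} {f₂} {r} p∈ face≡ = build (∈-∃++ (proj₁ (∈-face⁻ (subst (f₁ ∈_) (sym face≡) (here refl)))))
        where
        fs : List ℕ
        fs = take d (f₂ ∷ r)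
        fs⊆ : fs ⊆ f₂ ∷ r
        fs⊆ = take-⊆ d (f₂ ∷ r)
          where
          take-⊆ : ∀ k (xs : List ℕ) → take k xs ⊆ xs
          take-⊆ (suc k) (x ∷ xs) (here eq) = here eq
          take-⊆ (suc k) (x ∷ xs) (there z∈) = there (take-⊆ k xs z∈)
        F-good : GoodBlock (f₁ ∷ f₂ ∷ r)
        F-good = subst GoodBlock face≡ (face-good d (goodBlocksσ B∈) goodBlocksπ p∈)
        F↑ : Increasing (f₁ ∷ f₂ ∷ r)
        F↑ = subst Increasing face≡ (face-increasing p)
        length-fs : length fs ≡ d
        length-fs = trans (length-take d (f₂ ∷ r)) (m≤n⇒m⊓n≡m (≤-pred (≋1⇒d< (size F-good))))
        fs-AP : AP (suc f₁) fs
        fs-AP = fs-AP′ (progression F-good)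
          where
          fs-AP′ : AP f₁ (f₁ ∷ f₂ ∷ r) → AP (suc f₁) fs
          fs-AP′ (_ ∷ ap) = AP-take d ap
        fs-face : ∀ {g} → g ∈ fs → g ∈ face p
        fs-face {g} g∈ = subst (g ∈_) (sym face≡) (there (fs⊆ g∈))
        build : (∃ λ X → ∃ λ R → B ≡ X ++ f₁ ∷ R) → Found
        build (X , R , B≡) = finish (chunks R (AllPairs.tail (AllPairs-++⁻ʳ X XR↑)) (AllPairsₚ.take⁺ d (AllPairs.tail F↑))
            (λ g∈ → ∈-between X (<-irrefl refl) <-asym XR↑
              (subst (_ ∈_) B≡ (proj₁ (∈-face⁻ (fs-face g∈)))) (All.lookup (AllPairs.head F↑) (fs⊆ g∈))))
          where
          XR↑ : Increasing (X ++ f₁ ∷ R)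
          XR↑ = subst Increasing B≡ B↑
          R-AP : AP (suc f₁) R
          R-AP = R-AP′ (AP-++⁻ʳ X (subst (λ z → AP (hd B) z) B≡ (progression (goodBlocksσ B∈))))
            where
            R-AP′ : ∀ {b} → AP b (f₁ ∷ R) → AP (suc f₁) R
            R-AP′ (e ∷ ap) = AP-cong (≋-suc (≋-sym e)) ap
          finish : (∃ λ Cs → ∃ λ Q → R ≡ concat Cs ++ Q × map lst Cs ≡ fs × (∀ {C} → C ∈ Cs → C ≢ [])) → Found
          finish (Cs , Q , R≡ , fs≡ , ne) = B , X ∷ʳ f₁ , Cs , Q , proj₁ τ , record
              { isCut = proj₂ τ
              ; count = trans (sym (length-map lst Cs)) (trans (cong length fs≡) length-fs)
              ; sizes = chunk-sizes Cs Q (subst (AP (suc f₁)) R≡ R-AP) (subst (AP (suc f₁)) (sym fs≡) fs-AP) ne } ,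
            refines-cut (proj₂ τ) (subst (_∈ face p) (sym (lst-∷ʳ X f₁)) (subst (f₁ ∈_) (sym face≡) (here refl)))
              (λ {g} g∈ → fs-face (subst (g ∈_) fs≡ g∈))
            where
            τ : ∃ (Cut n σ B (X ∷ʳ f₁) Cs Q)
            τ = cut (X ∷ʳ f₁) Cs Q isσ ncσ B∈
              (trans B≡ (trans (cong (λ z → X ++ f₁ ∷ z) R≡) (sym (++-assoc X (f₁ ∷ []) (concat Cs ++ Q)))))
              (∈⇒≢[] (∈-++⁺ʳ X (here refl))) ne

      found : B ∉ π → Found
      found B∉ = from-break (break B∉)
        where
        from-break : (∃ λ C → ∃ λ p → ∃ λ x → C ∈ π × Consec B p x × p ∈ C × x ∉ C) → Found
        from-break (C , p , x , C∈ , con , p∈ , x∉) = from-second (second-in-face C∈ con p∈ x∉)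
          where
          from-two : (∃ λ f₁ → ∃ λ f₂ → ∃ λ r → face p ≡ f₁ ∷ f₂ ∷ r) → Found
          from-two (_ , _ , _ , eq) = cut-face (Consec.left con) eq
          from-second : (∃ λ g → p ≢ g × g ∈ face p) → Found
          from-second (g , p≢g , g∈) = from-two (two-elements p≢g (∈-face⁺ (Consec.left con) ∼-refl) g∈)

    find-cut : π ≢ σ → Found
    find-cut π≢σ = from-missing (missing-block π≢σ)
      where
      from-missing : (∃ λ B → B ∈ σ × B ∉ π) → Found
      from-missing (B , B∈ , B∉) = InBlock.found B∈ B∉

  covers⇒goodCut : ∀ {π σ} → Covers d n π σ → ∃ λ B → ∃ λ P → ∃ λ Cs → ∃ λ Q → GoodCut σ B P Cs Q π
  covers⇒goodCut {π} {σ} (inπ , inσ , π≤σ , π≢σ , minimal) =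
    choose (FindCut.find-cut (InNC⇒Good inπ) (InNC⇒Good inσ) π≤σ π≢σ)
    where
    choose : FindCut.Found (InNC⇒Good inπ) (InNC⇒Good inσ) π≤σ → ∃ λ B → ∃ λ P → ∃ λ Cs → ∃ λ Q → GoodCut σ B P Cs Q π
    choose (B , P , Cs , Q , τ , c , π≤τ) =
      decide (minimal τ (Good⇒InNC (goodCut-good (InNC⇒Good inσ) c)) π≤τ (CutFacts.cut-refines (proj₁ inσ) (GoodCut.isCut c)))
      where
      decide : τ ≡ π ⊎ τ ≡ σ → ∃ λ B → ∃ λ P → ∃ λ Cs → ∃ λ Q → GoodCut σ B P Cs Q π
      decide (inj₁ refl) = B , P , Cs , Q , c
      decide (inj₂ τ≡σ) = ⊥-elim (goodCut-≢ (InNC⇒Good inσ) c τ≡σ)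

  -- If τ ≤ ρ < σ, then `find-cut` gives a cut τ′ of σ above ρ. Both τ and τ′ have d more blocks
  -- than σ, so they are equal, and ρ is squeezed between them.
  goodCut⇒covers : ∀ {σ B P Cs Q τ} → Good n σ → GoodCut σ B P Cs Q τ → Covers d n τ σ
  goodCut⇒covers {σ} {τ = τ} goodσ c =
    Good⇒InNC goodτ , Good⇒InNC goodσ , CutFacts.cut-refines isσ (GoodCut.isCut c) , goodCut-≢ goodσ c , minimal
    where
    isσ : IsPartition n σ
    isσ = Good.isPartition goodσ
    goodτ : Good n τ
    goodτ = goodCut-good goodσ c
    minimal : ∀ ρ → InNC d n ρ → Refines τ ρ → Refines ρ σ → ρ ≡ τ ⊎ ρ ≡ σ
    minimal ρ inρ τ≤ρ ρ≤σ = decide (ρ ≟ᴾ σ)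
      where
      below : FindCut.Found (InNC⇒Good inρ) goodσ ρ≤σ → ρ ≡ τ
      below (B , P , Cs , Q , τ′ , c′ , ρ≤τ′) = refines-antisym (proj₁ inρ) isτ
          (λ D D∈ → subst (λ z → ∃ λ E → E ∈ z × D ⊆ E) (sym τ≡τ′) (ρ≤τ′ D D∈)) τ≤ρ
        where
        isτ : IsPartition n τ
        isτ = Good.isPartition goodτ
        τ≡τ′ : τ ≡ τ′
        τ≡τ′ = refines-length-≡ isτ (Cut.isPartition (GoodCut.isCut c′)) (refines-trans τ≤ρ ρ≤τ′)
          (trans (goodCut-length goodσ c) (sym (goodCut-length goodσ c′)))
      decide : Dec (ρ ≡ σ) → ρ ≡ τ ⊎ ρ ≡ σ
      decide (yes ρ≡σ) = inj₂ ρ≡σ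
      decide (no ρ≢σ) = inj₁ (below (FindCut.find-cut (InNC⇒Good inρ) goodσ ρ≤σ ρ≢σ))

-- Łukasiewicz words

-- Forest w m L says that L lists the vertices of an ordered forest of m trees in depth-first order,
-- the vertex x having w x * d children.
module Forests (d : ℕ) where

  open Modular d

  data Forest (w : ℕ → ℕ) : ℕ → List ℕ → Set where
    [] : Forest w 0 []
    _∷_ : ∀ {m} x {L} → Forest w (w x * d + m) L → Forest w (suc m) (x ∷ L)

  Forest-≡ : ∀ {w a b L} → a ≡ b → Forest w a L → Forest w b L
  Forest-≡ refl f = f

  Forest-cong : ∀ {w w′ m L} → (∀ {x} → x ∈ L → w x ≡ w′ x) → Forest w m L → Forest w′ m L
  Forest-cong h [] = []
  Forest-cong h (_∷_ {m} x f) = x ∷ Forest-≡ (cong (λ z → z * d + m) (h (here refl))) (Forest-cong (h ∘ there) f)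

  Forest-length : ∀ {w m L} → Forest w m L → length L ≋ m
  Forest-length [] = ≋-refl
  Forest-length {w} (_∷_ {m} x f) = ≋-suc (≋-trans (Forest-length f)
    (≋-trans (≋-reflexive (+-comm (w x * d) m)) (+-multiple-≋ m (w x))))

  Forest-++ : ∀ {w a b L M} → Forest w a L → Forest w b M → Forest w (a + b) (L ++ M)
  Forest-++ [] g = g
  Forest-++ {w} {b = b} (_∷_ {m} x f) g = x ∷ Forest-≡ (+-assoc (w x * d) m b) (Forest-++ f g)

  Forest-split : ∀ {w} a {b} L → Forest w (a + b) L →
    ∃ λ L₁ → ∃ λ L₂ → L ≡ L₁ ++ L₂ × Forest w a L₁ × Forest w b L₂
  Forest-split zero L f = [] , L , refl , [] , f
  Forest-split {w} (suc a) {b} (x ∷ L) (.x ∷ f)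
    with L₁ , L₂ , refl , f₁ , f₂ ← Forest-split (w x * d + a) L (Forest-≡ (sym (+-assoc (w x * d) a b)) f) =
    x ∷ L₁ , L₂ , refl , x ∷ f₁ , f₂

  -- The vertices read so far determine how many trees are still pending, and a word stops when this
  -- number first reaches 0. So no word with a given number of trees is a proper prefix of another.
  Forest-prefix-unique : ∀ {w a L L′ M M′} → Forest w a L → Forest w a L′ → L ++ M ≡ L′ ++ M′ → L ≡ L′ × M ≡ M′
  Forest-prefix-unique [] [] eq = refl , eq
  Forest-prefix-unique (x ∷ f) (y ∷ f′) eq with refl , eq′ ← ∷-injective eq
    with refl , eq″ ← Forest-prefix-unique f f′ eq′ = refl , eq″

  trees : ∀ {w} a {L} → Forest w a L → ∃ λ Cs → length Cs ≡ a × (∀ {C} → C ∈ Cs → Forest w 1 C) × L ≡ concat Cs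
  trees zero [] = [] , refl , (λ ()) , refl
  trees (suc a) {L} f with C , R , refl , t , g ← Forest-split 1 L f
    with Cs , refl , ts , refl ← trees a g =
    C ∷ Cs , refl , (λ { (here refl) → t ; (there D∈) → ts D∈ }) , refl

  Forest-concat : ∀ {w} Cs → (∀ {C} → C ∈ Cs → Forest w 1 C) → Forest w (length Cs) (concat Cs)
  Forest-concat [] _ = []
  Forest-concat (C ∷ Cs) ts = Forest-++ (ts (here refl)) (Forest-concat Cs (ts ∘ there))

  trees-unique : ∀ {w} Cs Cs′ {Q Q′} → (∀ {C} → C ∈ Cs → Forest w 1 C) → (∀ {C} → C ∈ Cs′ → Forest w 1 C) →
    length Cs ≡ length Cs′ → concat Cs ++ Q ≡ concat Cs′ ++ Q′ → Cs ≡ Cs′ × Q ≡ Q′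
  trees-unique [] [] _ _ _ eq = refl , eq
  trees-unique (C ∷ Cs) (C′ ∷ Cs′) {Q} {Q′} ts ts′ len eq
    with refl , eq′ ← Forest-prefix-unique (ts (here refl)) (ts′ (here refl))
           (trans (sym (++-assoc C (concat Cs) Q)) (trans eq (++-assoc C′ (concat Cs′) Q′)))
    with refl , refl ← trees-unique Cs Cs′ (ts ∘ there) (ts′ ∘ there) (suc-injective len) eq′ = refl , refl

  module _ {w w′ : ℕ → ℕ} {i : ℕ} (at : w′ i ≡ suc (w i)) (off : ∀ {x} → i ≢ x → w′ x ≡ w x) where

    private
      off-list : ∀ {L} → i ∉ L → ∀ {x} → x ∈ L → w′ x ≡ w x
      off-list {L} i∉ x∈ = off λ i≡x → i∉ (subst (_∈ L) (sym i≡x) x∈)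

      children : ∀ m → w′ i * d + m ≡ d + (w i * d + m)
      children m = trans (cong (λ z → z * d + m) at) (+-assoc d (w i * d) m)

    -- Under the new weights, reading i adds d pending trees. The word R consumes exactly these, and
    -- Q continues as before.
    graft : ∀ P {m R Q} → i ∉ P → i ∉ R ++ Q → Forest w m (P ++ i ∷ Q) → Forest w d R → Forest w′ m (P ++ i ∷ R ++ Q)
    graft [] _ i∉ (_∷_ {m} .i f) r =
      i ∷ Forest-≡ (sym (children m)) (Forest-cong (λ x∈ → sym (off-list i∉ x∈)) (Forest-++ r f))
    graft (x ∷ P) i∉P i∉ (_∷_ {m} .x f) r =
      x ∷ Forest-≡ (cong (λ z → z * d + m) (sym (off (i∉P ∘ here)))) (graft P (i∉P ∘ there) i∉ f r)

    -- The inverse of `graft`: the d additional trees opened at i are consumed first, and R stops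
    -- where they are complete.
    prune : ∀ P {m S} → i ∉ P → i ∉ S → Forest w′ m (P ++ i ∷ S) →
      ∃ λ R → ∃ λ Q → S ≡ R ++ Q × Forest w d R × Forest w m (P ++ i ∷ Q)
    prune [] {S = S} _ i∉ (_∷_ {m} .i f)
      with R , Q , S≡ , r , q ← Forest-split d S (Forest-≡ (children m) (Forest-cong (off-list i∉) f)) =
      R , Q , S≡ , r , i ∷ q
    prune (x ∷ P) i∉P i∉ (_∷_ {m} .x f)
      with R , Q , S≡ , r , q ← prune P (i∉P ∘ there) i∉ (Forest-≡ (cong (λ z → z * d + m) (off (i∉P ∘ here))) f) =
      R , Q , S≡ , r , x ∷ q

mult : List ℕ → ℕ → ℕ
mult [] x = 0
mult (a ∷ as) x = if does (a ≟ x) then suc (mult as x) else mult as x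

mult-at : ∀ i as → mult (i ∷ as) i ≡ suc (mult as i)
mult-at i as rewrite dec-true (i ≟ i) refl = refl

mult-off : ∀ {i x} as → i ≢ x → mult (i ∷ as) x ≡ mult as x
mult-off {i} {x} as i≢x rewrite dec-false (i ≟ x) i≢x = refl

snoc-view : ∀ {P} → P ≢ [] → ∃ λ X → P ≡ X ∷ʳ lst P
snoc-view {[]} ne = ⊥-elim (ne refl)
snoc-view {x ∷ []} _ = [] , refl
snoc-view {x ∷ y ∷ P} _ with X , eq ← snoc-view {y ∷ P} (λ ()) = x ∷ X , cong (x ∷_) eq

split-unique : ∀ {i : ℕ} X X′ {S S′} → i ∉ X → i ∉ X′ → X ++ i ∷ S ≡ X′ ++ i ∷ S′ → X ≡ X′ × S ≡ S′
split-unique [] [] _ _ refl = refl , refl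
split-unique [] (x ∷ X′) _ i∉ eq = ⊥-elim (i∉ (here (∷-injectiveˡ eq)))
split-unique (x ∷ X) [] i∉ _ eq = ⊥-elim (i∉ (here (sym (∷-injectiveˡ eq))))
split-unique (x ∷ X) (x′ ∷ X′) i∉ i∉′ eq with refl , eq′ ← ∷-injective eq
  with refl , refl ← split-unique X X′ (i∉ ∘ there) (i∉′ ∘ there) eq′ = refl , refl

increasing-∉ : ∀ X {i S} → Increasing (X ++ i ∷ S) → i ∉ X × i ∉ S
increasing-∉ X inc = (λ i∈ → <-irrefl refl (AllPairs-++-cross X inc i∈ (here refl))) ,
  λ i∈ → <-irrefl refl (All.lookup (AllPairs.head (AllPairs-++⁻ʳ X inc)) i∈)

-- Compatibility of partitions with lists of labels

module Compatibility (d m : ℕ) .{{_ : NonZero d}} (size-≋ : Modular._≋_ d (suc m) 1) where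

  open Modular d
  open Covering d m size-≋ public
  open Forests d public

  private
    n : ℕ
    n = suc m

  Compatible : Partition → List ℕ → Set
  Compatible σ as = ∀ {B} → B ∈ σ → Forest (mult as) 1 B

  private
    Forest-subst : ∀ {w k L M} → L ≡ M → Forest w k L → Forest w k M
    Forest-subst refl f = f

    snoc-++ : ∀ (X : List ℕ) i S → (X ∷ʳ i) ++ S ≡ X ++ i ∷ S
    snoc-++ X i S = ++-assoc X (i ∷ []) S

  -- The pieces are grafted as d first subtrees at i. No other block contains i, so the new label
  -- leaves the weights there unchanged.
  compatible-up : ∀ {σ B P Cs Q τ as} → Good n σ → GoodCut σ B P Cs Q τ → Compatible τ as → Compatible σ (lst P ∷ as)
  compatible-up {σ} {B} {P} {Cs} {Q} {τ} {as} goodσ c compat {D} D∈ = decide (D ≟ᴮ B)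
    where
    open GoodCut c
    open Cut isCut
    isσ : IsPartition n σ
    isσ = Good.isPartition goodσ
    open CutFacts isσ isCut
    i : ℕ
    i = lst P
    grafted : (∃ λ X → P ≡ X ∷ʳ i) → Forest (mult (i ∷ as)) 1 whole
    grafted (X , P≡) = Forest-subst (sym whole≡) (graft (mult-at i as) (mult-off as) X (proj₁ i∉) (proj₂ i∉)
        (Forest-subst (trans (cong (_++ Q) P≡) (snoc-++ X i Q)) (compat outer))
        (Forest-≡ count (Forest-concat Cs (compat ∘ pieces))))
      where
      whole≡ : whole ≡ X ++ i ∷ concat Cs ++ Q
      whole≡ = trans (cong (_++ (concat Cs ++ Q)) P≡) (snoc-++ X i (concat Cs ++ Q))
      i∉ : i ∉ X × i ∉ concat Cs ++ Q
      i∉ = increasing-∉ X (subst Increasing whole≡ whole-increasing)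
    decide : Dec (D ≡ B) → Forest (mult (i ∷ as)) 1 D
    decide (yes refl) = Forest-subst (sym cut-≡) (grafted (snoc-view outer-≢[]))
    decide (no D≢B) = Forest-cong (λ {x} x∈ → sym (mult-off as λ i≡x → D≢B (trans
      (uniq isσ D∈ whole-∈ x∈ (subst (_∈ whole) i≡x (outer⊆whole (∈-++⁺ˡ (lst-∈ outer-≢[]))))) (sym cut-≡))))
      (compat (kept D∈ D≢B))

  Below : Partition → ℕ → List ℕ → Set
  Below σ i as = ∃ λ B → ∃ λ P → ∃ λ Cs → ∃ λ Q → ∃ λ τ → GoodCut σ B P Cs Q τ × lst P ≡ i × Compatible τ as

  -- Pruning at i detaches d trees, which become the pieces. The required sizes come for free from
  -- `Forest-length`: since every vertex has a multiple of d children, a tree has ≡ 1 vertices.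
  compatible-down : ∀ {σ i as} → Good n σ → 1 ≤ i → i ≤ n → Compatible σ (i ∷ as) → Below σ i as
  compatible-down {σ} {i} {as} (good isσ ncσ _) 1≤i i≤n compat = from-block (cover isσ 1≤i i≤n)
    where
    from-block : (∃ λ B → B ∈ σ × i ∈ B) → Below σ i as
    from-block (B , B∈ , i∈) = from-position (∈-∃++ i∈)
      where
      from-position : (∃ λ X → ∃ λ S → B ≡ X ++ i ∷ S) → Below σ i as
      from-position (X , S , B≡) = from-prune (prune (mult-at i as) (mult-off as) X (proj₁ i∉) (proj₂ i∉) (Forest-subst B≡ (compat B∈)))
        where
        i∉ : i ∉ X × i ∉ S
        i∉ = increasing-∉ X (subst Increasing B≡ (block-increasing isσ B∈))
        from-prune : (∃ λ R → ∃ λ Q → S ≡ R ++ Q × Forest (mult as) d R × Forest (mult as) 1 (X ++ i ∷ Q)) → Below σ i as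
        from-prune (R , Q , S≡ , r , f) = from-trees (trees d r)
          where
          from-trees : (∃ λ Cs → length Cs ≡ d × (∀ {C} → C ∈ Cs → Forest (mult as) 1 C) × R ≡ concat Cs) → Below σ i as
          from-trees (Cs , count , ts , R≡) = B , X ∷ʳ i , Cs , Q , proj₁ τ ,
            record { isCut = proj₂ τ ; count = count ; sizes = Forest-length ∘ ts } , lst-∷ʳ X i , λ D∈ → compat′ D∈ (blocks D∈)
            where
            tree-≢[] : ∀ {w L} → Forest w 1 L → L ≢ []
            tree-≢[] (_ ∷ _) ()
            B≡′ : B ≡ X ∷ʳ i ++ concat Cs ++ Q
            B≡′ = trans B≡ (trans (cong (λ z → X ++ i ∷ z) (trans S≡ (cong (_++ Q) R≡))) (sym (snoc-++ X i (concat Cs ++ Q))))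
            τ : ∃ (Cut n σ B (X ∷ʳ i) Cs Q)
            τ = cut (X ∷ʳ i) Cs Q isσ ncσ B∈ B≡′ (∈⇒≢[] (∈-++⁺ʳ X (here refl))) (tree-≢[] ∘ ts)
            open Cut (proj₂ τ) using (blocks)
            compat′ : ∀ {D} → D ∈ proj₁ τ → (D ∈ σ × D ≢ B) ⊎ D ≡ X ∷ʳ i ++ Q ⊎ D ∈ Cs → Forest (mult as) 1 D
            compat′ _ (inj₁ (D∈σ , D≢B)) = Forest-cong (λ {x} x∈ → mult-off as λ i≡x → D≢B
              (uniq isσ D∈σ B∈ x∈ (subst (_∈ B) i≡x i∈))) (compat D∈σ)
            compat′ _ (inj₂ (inj₁ D≡)) = Forest-subst (sym (trans D≡ (snoc-++ X i Q))) f
            compat′ _ (inj₂ (inj₂ D∈Cs)) = ts D∈Cs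

  cut-⊆ : ∀ {σ B P Cs Q τ τ′} → Cut n σ B P Cs Q τ → Cut n σ B P Cs Q τ′ → τ ⊆ τ′
  cut-⊆ c c′ D∈ with Cut.blocks c D∈
  ... | inj₁ (D∈σ , D≢B) = Cut.kept c′ D∈σ D≢B
  ... | inj₂ (inj₁ refl) = Cut.outer c′
  ... | inj₂ (inj₂ D∈Cs) = Cut.pieces c′ D∈Cs

  -- The element i fixes both the block and P. What follows i is the same word in both cuts, and
  -- unique decoding splits it into the same d trees and the same Q.
  compatible-unique : ∀ {σ B P Cs Q τ B′ P′ Cs′ Q′ τ′ as} → Good n σ → GoodCut σ B P Cs Q τ → GoodCut σ B′ P′ Cs′ Q′ τ′ →
    lst P ≡ lst P′ → Compatible τ as → Compatible τ′ as → τ ≡ τ′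
  compatible-unique {σ} {B} {P} {Cs} {Q} {τ} {B′} {P′} {Cs′} {Q′} {τ′} {as} goodσ c c′ lst≡ compat compat′ =
    from-snoc (snoc-view (Cut.outer-≢[] C₁)) (snoc-view (Cut.outer-≢[] C₂))
    where
    isσ : IsPartition n σ
    isσ = Good.isPartition goodσ
    C₁ : Cut n σ B P Cs Q τ
    C₁ = GoodCut.isCut c
    C₂ : Cut n σ B′ P′ Cs′ Q′ τ′
    C₂ = GoodCut.isCut c′
    module F₁ = CutFacts isσ C₁
    module F₂ = CutFacts isσ C₂
    i : ℕ
    i = lst P
    i∈₁ : i ∈ F₁.whole
    i∈₁ = F₁.outer⊆whole (∈-++⁺ˡ (lst-∈ (Cut.outer-≢[] C₁)))
    i∈₂ : i ∈ F₂.whole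
    i∈₂ = subst (_∈ F₂.whole) (sym lst≡) (F₂.outer⊆whole (∈-++⁺ˡ (lst-∈ (Cut.outer-≢[] C₂))))
    whole≡ : F₁.whole ≡ F₂.whole
    whole≡ = uniq isσ F₁.whole-∈ F₂.whole-∈ i∈₁ i∈₂
    B≡B′ : B ≡ B′
    B≡B′ = trans (Cut.cut-≡ C₁) (trans whole≡ (sym (Cut.cut-≡ C₂)))
    from-snoc : (∃ λ X → P ≡ X ∷ʳ i) → (∃ λ X → P′ ≡ X ∷ʳ lst P′) → τ ≡ τ′
    from-snoc (X , P≡) (X′ , P′≡) = from-split (split-unique X X′ (i∉ X e₁ F₁.whole-increasing) (i∉ X′ e₂ F₂.whole-increasing)
        (trans (sym e₁) (trans whole≡ e₂)))
      where
      e₁ : F₁.whole ≡ X ++ i ∷ concat Cs ++ Q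
      e₁ = trans (cong (_++ (concat Cs ++ Q)) P≡) (snoc-++ X i (concat Cs ++ Q))
      e₂ : F₂.whole ≡ X′ ++ i ∷ concat Cs′ ++ Q′
      e₂ = trans (cong (_++ (concat Cs′ ++ Q′)) (trans P′≡ (cong (X′ ∷ʳ_) (sym lst≡)))) (snoc-++ X′ i (concat Cs′ ++ Q′))
      i∉ : ∀ Y {S L} → L ≡ Y ++ i ∷ S → Increasing L → i ∉ Y
      i∉ Y refl inc = proj₁ (increasing-∉ Y inc)
      from-split : X ≡ X′ × concat Cs ++ Q ≡ concat Cs′ ++ Q′ → τ ≡ τ′
      from-split (X≡ , S≡) = from-trees (trees-unique Cs Cs′ (compat ∘ Cut.pieces C₁) (compat′ ∘ Cut.pieces C₂)
          (trans (GoodCut.count c) (sym (GoodCut.count c′))) S≡)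
        where
        P≡P′ : P ≡ P′
        P≡P′ = trans P≡ (trans (cong₂ _∷ʳ_ X≡ lst≡) (sym P′≡))
        same : ∀ {B′ P′ Cs′ Q′} → B ≡ B′ → P ≡ P′ → Cs ≡ Cs′ → Q ≡ Q′ → Cut n σ B′ P′ Cs′ Q′ τ′ → τ ≡ τ′
        same refl refl refl refl k = ∈-antisym (Cut.isPartition C₁) (Cut.isPartition k) (cut-⊆ C₁ k) (cut-⊆ k C₁)
        from-trees : Cs ≡ Cs′ × Q ≡ Q′ → τ ≡ τ′
        from-trees (Cs≡ , Q≡) = same B≡B′ P≡P′ Cs≡ Q≡ C₂

-- Parking functions as Łukasiewicz words

mult-↭ : ∀ {as bs} → as ↭ bs → ∀ x → mult as x ≡ mult bs x
mult-↭ _↭_.refl x = refl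
mult-↭ (prep a p) x with does (a ≟ x)
... | true = cong suc (mult-↭ p x)
... | false = mult-↭ p x
mult-↭ (swap a b p) x with does (a ≟ x) | does (b ≟ x)
... | true | true = cong (suc ∘ suc) (mult-↭ p x)
... | true | false = cong suc (mult-↭ p x)
... | false | true = cong suc (mult-↭ p x)
... | false | false = mult-↭ p x
mult-↭ (_↭_.trans p q) x = trans (mult-↭ p x) (mult-↭ q x)

mult-absent : ∀ {x} s → x ∉ s → mult s x ≡ 0
mult-absent [] _ = refl
mult-absent (a ∷ s) x∉ = trans (mult-off s (x∉ ∘ here ∘ sym)) (mult-absent s (x∉ ∘ there))

module Parking (d : ℕ) where

  open Forests d
  open Modular d

  -- What remains of a sorted list s of numbers ≥ x after all copies of x are removed.
  record Peeled (x : ℕ) (s : List ℕ) : Set where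
    field
      rest     : List ℕ
      sorted   : AllPairs _≤_ rest
      above    : All (x <_) rest
      rest-⊆   : rest ⊆ s
      mult-≡   : ∀ {y} → x < y → mult s y ≡ mult rest y
      length-≡ : length s ≡ mult s x + length rest
      bound⁻   : ∀ j → PFBound d j s → PFBound d (j + mult s x) rest
      bound⁺   : ∀ j → x ≤ d * j + 1 → PFBound d (j + mult s x) rest → PFBound d j s

  private
    PFBound-≡ : ∀ {i j s} → i ≡ j → PFBound d i s → PFBound d j s
    PFBound-≡ refl b = b

  peel : ∀ x s → AllPairs _≤_ s → All (x ≤_) s → Peeled x s
  peel x [] _ _ = record { rest = [] ; sorted = [] ; above = [] ; rest-⊆ = id ; mult-≡ = λ _ → refl ; length-≡ = refl
                         ; bound⁻ = λ _ _ → tt ; bound⁺ = λ _ _ _ → tt }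
  peel x (a ∷ s) (a≤ ∷ s↑) (x≤a ∷ x≤) with x ≟ a
  ... | yes refl = record
    { rest = rest ; sorted = sorted ; above = above ; rest-⊆ = there ∘ rest-⊆
    ; mult-≡ = λ x<y → trans (mult-off s (<⇒≢ x<y)) (mult-≡ x<y)
    ; length-≡ = trans (cong suc length-≡) (cong (_+ length rest) (sym (mult-at x s)))
    ; bound⁻ = λ j (_ , b) → PFBound-≡ (index j) (bound⁻ (suc j) b)
    -- The bounds grow along the list, so the bound at the first copy of x implies those at the
    -- later copies.
    ; bound⁺ = λ j x≤ b → x≤ , bound⁺ (suc j) (≤-trans x≤ (+-monoˡ-≤ 1 (*-monoʳ-≤ d (n≤1+n j)))) (PFBound-≡ (sym (index j)) b) }
    where
    open Peeled (peel x s s↑ x≤)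
    index : ∀ j → suc j + mult s x ≡ j + mult (x ∷ s) x
    index j = trans (sym (+-suc j (mult s x))) (cong (j +_) (sym (mult-at x s)))
  ... | no x≢a = record
    { rest = a ∷ s ; sorted = a≤ ∷ s↑ ; above = x<s ; rest-⊆ = id ; mult-≡ = λ _ → refl
    ; length-≡ = cong (_+ length (a ∷ s)) (sym absent)
    ; bound⁻ = λ j → PFBound-≡ (sym (index j)) ; bound⁺ = λ j _ → PFBound-≡ (index j) }
    where
    x<a : x < a
    x<a = ≤∧≢⇒< x≤a x≢a
    x<s : All (x <_) (a ∷ s)
    x<s = x<a ∷ All.map (<-≤-trans x<a) a≤
    absent : mult (a ∷ s) x ≡ 0
    absent = mult-absent (a ∷ s) λ x∈ → <-irrefl refl (All.lookup x<s x∈)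
    index : ∀ j → j + mult (a ∷ s) x ≡ j
    index j = trans (cong (j +_) absent) (+-identityʳ j)

  private
    -- Reading x, which occurs c times among the labels, consumes one pending tree and opens c · d
    -- new ones.
    stack : ∀ {m x j} c → suc m + x ≡ 2 + d * j → c * d + m + suc x ≡ 2 + d * (j + c)
    stack {m} {x} {j} c eq = trans (left c d m x) (trans (cong (c * d +_) eq) (right c d j))
      where
      left : ∀ c d m x → c * d + m + suc x ≡ c * d + (suc m + x)
      left = solve-∀
      right : ∀ c d j → c * d + (2 + d * j) ≡ 2 + d * (j + c)
      right = solve-∀

    end : ∀ {x l j t} c t′ → t ≡ c + t′ → x + suc l ≡ d * (j + t) + 2 → suc x + l ≡ d * (j + c + t′) + 2
    end {x} {l} {j} c t′ refl eq =
      trans (sym (+-suc x l)) (trans eq (cong (λ z → d * z + 2) (sym (+-assoc j c t′))))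

    end⁻ : ∀ {x l j t} c t′ → t ≡ c + t′ → suc x + l ≡ d * (j + c + t′) + 2 → x + suc l ≡ d * (j + t) + 2
    end⁻ {x} {l} {j} c t′ refl eq =
      trans (+-suc x l) (trans eq (cong (λ z → d * z + 2) (+-assoc j c t′)))

  -- After the labels below x, say j of them, have been read, m = d j + 2 − x trees remain.
  parking⇒forest : ∀ l x j m s → AllPairs _≤_ s → All (x ≤_) s → PFBound d j s → m + x ≡ 2 + d * j →
    x + l ≡ d * (j + length s) + 2 → Forest (mult s) m (interval x l)
  parking⇒forest zero x j m s _ _ _ stack≡ end≡ = Forest-≡ (sym m≡0) []
    where
    x≥ : 2 + d * j ≤ x
    x≥ = begin
      2 + d * j                ≤⟨ +-monoʳ-≤ 2 (*-monoʳ-≤ d (m≤m+n j (length s))) ⟩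
      2 + d * (j + length s)   ≡⟨ +-comm 2 _ ⟩
      d * (j + length s) + 2   ≡⟨ end≡ ⟨
      x + 0                    ≡⟨ +-identityʳ x ⟩
      x                        ∎
      where open ≤-Reasoning
    m≡0 : m ≡ 0
    m≡0 = n≤0⇒n≡0 (+-cancelʳ-≤ x m 0 (≤-trans (≤-reflexive stack≡) x≥))
  parking⇒forest (suc l) x j zero [] _ _ _ stack≡ end≡ = ⊥-elim (<-irrefl x≡ (m<m+n x (s≤s z≤n)))
    where
    x≡ : x ≡ x + suc l
    x≡ = trans stack≡ (trans (+-comm 2 (d * j)) (trans (cong (λ z → d * z + 2) (sym (+-identityʳ j))) (sym end≡)))
  -- With no tree pending, x = d j + 2, whereas the next label is ≥ x and, by the parking bound, ≤ d
  -- j + 1.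
  parking⇒forest (suc l) x j zero (a ∷ s) _ (x≤a ∷ _) (a≤ , _) stack≡ _ =
    ⊥-elim (<⇒≱ (≤-reflexive (trans (cong suc (+-comm (d * j) 1)) (sym stack≡))) (≤-trans x≤a a≤))
  parking⇒forest (suc l) x j (suc m) s s↑ x≤ b stack≡ end≡ =
    x ∷ Forest-cong (λ y∈ → sym (mult-≡ (proj₁ (∈-interval⁻ (suc x) l y∈))))
      (parking⇒forest l (suc x) (j + mult s x) (mult s x * d + m) rest sorted above (bound⁻ j b)
        (stack (mult s x) stack≡) (end {l = l} {j} (mult s x) (length rest) length-≡ end≡))
    where open Peeled (peel x s s↑ x≤)

  -- A tree must be pending when x is read, and `suc m + x ≡ 2 + d * j` then says x ≤ d j + 1, the
  -- bound for the first copy of x. That none is pending at the end determines the number of labels.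
  forest⇒parking : ∀ l x j m s → AllPairs _≤_ s → All (x ≤_) s → All (_< x + l) s → m + x ≡ 2 + d * j →
    Forest (mult s) m (interval x l) → PFBound d j s × x + l ≡ d * (j + length s) + 2
  forest⇒parking zero x j zero [] _ _ _ stack≡ [] =
    tt , trans (+-identityʳ x) (trans stack≡ (trans (+-comm 2 (d * j)) (cong (λ z → d * z + 2) (sym (+-identityʳ j)))))
  forest⇒parking zero x j m (a ∷ s) _ (x≤a ∷ _) (a< ∷ _) _ _ = ⊥-elim (<⇒≱ (subst (a <_) (+-identityʳ x) a<) x≤a)
  forest⇒parking (suc l) x j (suc m) s s↑ x≤ <end stack≡ (.x ∷ f) =
    let b , end≡ = forest⇒parking l (suc x) (j + mult s x) (mult s x * d + m) rest sorted above
                     (All.tabulate λ {y} y∈ → subst (y <_) (+-suc x l) (All.lookup <end (rest-⊆ y∈)))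
                     (stack (mult s x) stack≡)
                     (Forest-cong (λ y∈ → mult-≡ (proj₁ (∈-interval⁻ (suc x) l y∈))) f)
    in bound⁺ j x≤bound b , end⁻ {l = l} {j} (mult s x) (length rest) length-≡ end≡
    where
    open Peeled (peel x s s↑ x≤)
    x≤bound : x ≤ d * j + 1
    x≤bound = subst (x ≤_) (+-comm 1 (d * j)) (≤-trans (m≤n+m x m) (≤-reflexive (suc-injective stack≡)))

  PFBound-upper : ∀ j s → PFBound d j s → All (_≤ d * (j + length s) + 1) s
  PFBound-upper j [] _ = []
  PFBound-upper j (a ∷ s) (a≤ , b) =
    ≤-trans a≤ (+-monoˡ-≤ 1 (*-monoʳ-≤ d (m≤m+n j (suc (length s))))) ∷
    subst (λ z → All (_≤ d * z + 1) s) (sym (+-suc j (length s))) (PFBound-upper (suc j) s b)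

  module _ (k : ℕ) .{{_ : NonZero d}} where

    private
      n : ℕ
      n = suc (d * k)

    InRange : ℕ → Set
    InRange a = 1 ≤ a × a ≤ n

    isParking⇒range : ∀ {a} → IsParkingFunction d k a → All InRange a
    isParking⇒range {a} (len , 1≤ , s , s↭a , _ , b) = All.tabulate λ {x} x∈ → All.lookup 1≤ x∈ ,
      subst (x ≤_) (trans (cong (λ z → d * z + 1) (trans (↭-length s↭a) len)) (+-comm (d * k) 1))
        (All.lookup (PFBound-upper 0 s b) (∈-resp-↭ (↭-sym s↭a) x∈))

    isParking⇒forest : ∀ {a} → IsParkingFunction d k a → Forest (mult a) 1 (interval 1 n)
    isParking⇒forest {a} (len , 1≤ , s , s↭a , s↑ , b) = Forest-cong (λ {x} _ → mult-↭ s↭a x)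
      (parking⇒forest n 1 0 1 s (Linked⇒AllPairs ≤-trans s↑) (All-resp-↭ (↭-sym s↭a) 1≤) b
        (cong (2 +_) (sym (*-zeroʳ d)))
        (trans (cong (2 +_) (cong (d *_) (sym (trans (↭-length s↭a) len)))) (+-comm 2 (d * length s))))

    forest⇒isParking : ∀ {a} → All InRange a → Forest (mult a) 1 (interval 1 n) → IsParkingFunction d k a
    forest⇒isParking {a} inRange f =
      -- As `1 + n` is `d * k + 2`, the end equation of `forest⇒parking` compares `d * length a`
      -- with `d * k`.
      *-cancelˡ-≡ (length a) k d (+-cancelʳ-≡ 2 _ _ (trans (cong (λ z → d * z + 2) (sym (↭-length s↭a)))
        (trans (sym (proj₂ result)) (+-comm 2 (d * k))))) ,
      All.map proj₁ inRange , s , s↭a , sort-↗ a , proj₁ result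
      where
      s : List ℕ
      s = sort a
      s↭a : s ↭ a
      s↭a = sort-↭ a
      inRange-s : All InRange s
      inRange-s = All-resp-↭ (↭-sym s↭a) inRange
      result : PFBound d 0 s × 1 + n ≡ d * length s + 2
      result = forest⇒parking n 1 0 1 s (Linked⇒AllPairs ≤-trans (sort-↗ a)) (All.map proj₁ inRange-s)
        (All.map (s≤s ∘ proj₂) inRange-s) (cong (2 +_) (sym (*-zeroʳ d)))
        (Forest-cong (λ {x} _ → mult-↭ (↭-sym s↭a) x) f)

-- Maximal chains

final : Partition → List Partition → Partition
final π [] = π
final π (σ ∷ ρs) = final σ ρs

∷ʳ⇒final : ∀ {π ρs} init {t} → π ∷ ρs ≡ init ∷ʳ t → final π ρs ≡ t
∷ʳ⇒final [] refl = refl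
∷ʳ⇒final {ρs = []} (_ ∷ []) ()
∷ʳ⇒final {ρs = []} (_ ∷ _ ∷ _) ()
∷ʳ⇒final {ρs = _ ∷ _} (_ ∷ init) eq = ∷ʳ⇒final init (∷-injectiveʳ eq)

final⇒∷ʳ : ∀ π ρs → ∃ λ init → π ∷ ρs ≡ init ∷ʳ final π ρs
final⇒∷ʳ π [] = [] , refl
final⇒∷ʳ π (σ ∷ ρs) with init , eq ← final⇒∷ʳ σ ρs = π ∷ init , cong (π ∷_) eq

module Chains (d k : ℕ) .{{_ : NonZero d}} where

  open Modular d

  private
    n : ℕ
    n = suc (d * k)

    size-≋ : n ≋ 1
    size-≋ = ≋-trans (≋-reflexive (cong suc (*-comm d k))) (+-multiple-≋ 1 k)

  open Compatibility d (d * k) size-≋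
  open Parking d

  private
    Range : ℕ → Set
    Range = InRange k

  label-goodCut : ∀ {σ B P Cs Q τ} → Good n σ → GoodCut σ B P Cs Q τ → label τ σ ≡ lst P
  label-goodCut {Cs = []} _ c = ⊥-elim (≢-nonZero⁻¹ d (sym (GoodCut.count c)))
  label-goodCut {Cs = _ ∷ _} goodσ c = label-cut (Good.isPartition goodσ) (GoodCut.isCut c)

  label-range : ∀ {σ B P Cs Q τ} → Good n σ → GoodCut σ B P Cs Q τ → Range (label τ σ)
  label-range {P = P} goodσ c = subst Range (sym (label-goodCut goodσ c))
    (range (Good.isPartition goodσ) whole-∈ (outer⊆whole (∈-++⁺ˡ (lst-∈ (Cut.outer-≢[] isCut)))))
    where
    open GoodCut c
    open CutFacts (Good.isPartition goodσ) isCut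

  covers-compatible : ∀ {π σ as} → Covers d n π σ → Compatible π as → All Range as →
    Compatible σ (label π σ ∷ as) × All Range (label π σ ∷ as)
  covers-compatible {π} {σ} {as} cov compat ranges = from-cut (covers⇒goodCut cov)
    where
    goodσ : Good n σ
    goodσ = InNC⇒Good (proj₁ (proj₂ cov))
    from-cut : (∃ λ B → ∃ λ P → ∃ λ Cs → ∃ λ Q → GoodCut σ B P Cs Q π) →
      Compatible σ (label π σ ∷ as) × All Range (label π σ ∷ as)
    from-cut (B , P , Cs , Q , c) =
      (λ {D} → subst (λ i → Compatible σ (i ∷ as)) (sym (label-goodCut goodσ c)) (compatible-up {as = as} goodσ c compat) {D}) ,
      label-range goodσ c ∷ ranges

  covers-unique : ∀ {π π′ σ as} → Covers d n π σ → Covers d n π′ σ → label π σ ≡ label π′ σ →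
    Compatible π as → Compatible π′ as → π ≡ π′
  covers-unique {π} {π′} {σ} {as} cov cov′ label≡ compat compat′ = from-cuts (covers⇒goodCut cov) (covers⇒goodCut cov′)
    where
    goodσ : Good n σ
    goodσ = InNC⇒Good (proj₁ (proj₂ cov))
    from-cuts : (∃ λ B → ∃ λ P → ∃ λ Cs → ∃ λ Q → GoodCut σ B P Cs Q π) →
      (∃ λ B → ∃ λ P → ∃ λ Cs → ∃ λ Q → GoodCut σ B P Cs Q π′) → π ≡ π′
    from-cuts (_ , _ , _ , _ , c) (_ , _ , _ , _ , c′) = compatible-unique {as = as} goodσ c c′
      (trans (sym (label-goodCut goodσ c)) (trans label≡ (label-goodCut goodσ c′))) compat compat′

  -- Going up, every new label is put in front, so the last partition is compatible with the
  -- reversed labels; since only multiplicities matter, the reversal can be undone at the end.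
  compatible-chain : ∀ {π} ρs {as} → Linked (Covers d n) (π ∷ ρs) → Compatible π as → All Range as →
    Compatible (final π ρs) (labels (π ∷ ρs) ʳ++ as) × All Range (labels (π ∷ ρs) ʳ++ as)
  compatible-chain [] _ compat ranges = compat , ranges
  compatible-chain (σ ∷ ρs) (cov ∷ covs) compat ranges =
    let compat′ , ranges′ = covers-compatible cov compat ranges in compatible-chain ρs covs compat′ ranges′

  -- The recursion climbs to the common top, and equality then descends through `covers-unique`. One
  -- list `as` serves both chains, because the labels already passed agree.
  chain-unique : ∀ {π π′} ρs ρs′ {as} → Linked (Covers d n) (π ∷ ρs) → Linked (Covers d n) (π′ ∷ ρs′) →
    Compatible π as → Compatible π′ as → All Range as → final π ρs ≡ final π′ ρs′ →
    labels (π ∷ ρs) ≡ labels (π′ ∷ ρs′) → π ∷ ρs ≡ π′ ∷ ρs′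
  chain-unique [] [] _ _ _ _ _ refl _ = refl
  chain-unique {π} {π′} (σ ∷ ρs) (σ′ ∷ ρs′) {as} (cov ∷ covs) (cov′ ∷ covs′) compat compat′ ranges fin lab =
    extend (chain-unique ρs ρs′ covs covs′
      (proj₁ (covers-compatible cov compat ranges))
      (λ {D} → subst (λ i → Compatible σ′ (i ∷ as)) (sym (∷-injectiveˡ lab)) (proj₁ (covers-compatible cov′ compat′ ranges)) {D})
      (proj₂ (covers-compatible cov compat ranges)) fin (∷-injectiveʳ lab))
    where
    extend : σ ∷ ρs ≡ σ′ ∷ ρs′ → π ∷ σ ∷ ρs ≡ π′ ∷ σ′ ∷ ρs′
    extend refl = cong (_∷ σ ∷ ρs) (covers-unique {as = as} cov cov′ (∷-injectiveˡ lab) compat compat′)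

  compatible-bottom : Compatible (bottom n) []
  compatible-bottom B∈ with x , _ , refl ← ∈-bottom⁻ {n} B∈ = x ∷ []

  private
    single : ∀ {B} → Forest (mult []) 1 B → ∃ λ x → B ≡ x ∷ []
    single (x ∷ []) = x , refl

  -- Without labels every vertex is a leaf, so every tree is a single vertex.
  compatible-[]⇒bottom : ∀ {σ} → IsPartition n σ → Compatible σ [] → σ ≡ bottom n
  compatible-[]⇒bottom {σ} isσ compat = ∈-antisym isσ (bottom-isPartition n) σ⊆ ⊆σ
    where
    σ⊆ : σ ⊆ bottom n
    σ⊆ B∈ with x , refl ← single (compat B∈) = let (a , b) = range isσ B∈ (here refl) in ∈-bottom⁺ a b
    ⊆σ : bottom n ⊆ σ
    ⊆σ {C} C∈ with x , (a , b) , refl ← ∈-bottom⁻ {n} C∈ = from-cover (cover isσ a b)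
      where
      from-cover : (∃ λ B → B ∈ σ × x ∈ B) → x ∷ [] ∈ σ
      from-cover (B , B∈ , x∈) with y , refl ← single (compat B∈) with here refl ← x∈ = B∈

  record ChainTo (π : Partition) (as : List ℕ) : Set where
    field
      elements : List Partition
      inNC     : All (InNC d n) (π ∷ elements)
      linked   : Linked (Covers d n) (π ∷ elements)
      ends     : final π elements ≡ top n
      labels-≡ : labels (π ∷ elements) ≡ as

  -- The list bs holds the labels still to be used, in the order of descent, so the last label of
  -- the future chain comes first. Each step removes one from the invariant and puts it in front of
  -- the labels above; when none is left, σ is the bottom.
  extend-down : ∀ bs {σ as} → Good n σ → Compatible σ bs → All Range bs → ChainTo σ as → ChainTo (bottom n) (bs ʳ++ as)
  extend-down [] {σ} {as} goodσ compat _ chain =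
    subst (λ π → ChainTo π as) (compatible-[]⇒bottom (Good.isPartition goodσ) compat) chain
  extend-down (i ∷ bs) {σ} {as} goodσ compat (inRange ∷ ranges) chain =
    from-below (compatible-down {as = bs} goodσ (proj₁ inRange) (proj₂ inRange) compat)
    where
    open ChainTo chain
    from-below : Below σ i bs → ChainTo (bottom n) (bs ʳ++ (i ∷ as))
    from-below (B , P , Cs , Q , τ , c , lst≡ , compatτ) = extend-down bs (goodCut-good goodσ c) compatτ ranges (record
      { elements = σ ∷ elements
      ; inNC = Good⇒InNC (goodCut-good goodσ c) ∷ inNC
      ; linked = goodCut⇒covers goodσ c ∷ linked
      ; ends = ends
      ; labels-≡ = cong₂ _∷_ (trans (label-goodCut goodσ c) lst≡) labels-≡ })

  chain⇒parking : (m : List Partition) → MaxChain d n m → IsParkingFunction d k (labels m)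
  chain⇒parking m ((ρs , refl) , (init , m≡) , _ , covs) = forest⇒isParking k
      (All-resp-↭ reversed (proj₂ chain))
      (Forest-cong (λ {x} _ → mult-↭ reversed x) (proj₁ chain
        (subst (interval 1 n ∈_) (sym (∷ʳ⇒final init m≡)) (interval-∈-top n))))
    where
    chain : Compatible (final (bottom n) ρs) (reverse (labels m)) × All Range (reverse (labels m))
    chain = compatible-chain ρs covs compatible-bottom []
    reversed : reverse (labels m) ↭ labels m
    reversed = ↭-reverse (labels m)

  labels-injective : (m m′ : List Partition) → MaxChain d n m → MaxChain d n m′ → labels m ≡ labels m′ → m ≡ m′
  labels-injective m m′ ((ρs , refl) , (init , m≡) , _ , covs) ((ρs′ , refl) , (init′ , m′≡) , _ , covs′) =
    chain-unique ρs ρs′ covs covs′ compatible-bottom compatible-bottom []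
      (trans (∷ʳ⇒final init m≡) (sym (∷ʳ⇒final init′ m′≡)))

  labels-surjective : (a : List ℕ) → IsParkingFunction d k a → ∃ λ m → MaxChain d n m × labels m ≡ a
  labels-surjective a isPF = bottom n ∷ elements , ((elements , refl) , ends-top , inNC , linked) ,
      trans labels-≡ (reverse-involutive a)
    where
    a↭ : a ↭ reverse a
    a↭ = ↭-sym (↭-reverse a)
    compat-top : Compatible (top n) (reverse a)
    compat-top B∈ = subst (Forest (mult (reverse a)) 1) (sym (∈-top⁻ {n} B∈))
      (Forest-cong (λ {x} _ → mult-↭ a↭ x) (isParking⇒forest k isPF))
    chain : ChainTo (bottom n) (reverse (reverse a))
    -- The descent starts with the last label of a, so it is fed the reversed list; reversing again
    -- restores a.
    chain = extend-down (reverse a) top-good compat-top (All-resp-↭ a↭ (isParking⇒range k isPF))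
      (record { elements = [] ; inNC = Good⇒InNC top-good ∷ [] ; linked = [-] ; ends = refl ; labels-≡ = refl })
    open ChainTo chain
    ends-top : ∃ λ init → bottom n ∷ elements ≡ init ∷ʳ top n
    ends-top = let (init , eq) = final⇒∷ʳ (bottom n) elements in init , trans eq (cong (init ∷ʳ_) ends)

theorem7p1 : (d k : ℕ) → .{{_ : NonZero d}} →
    ((m : List Partition) → MaxChain d (d * k + 1) m →
    IsParkingFunction d k (labels m))
    × ((m m′ : List Partition) → MaxChain d (d * k + 1) m →
    MaxChain d (d * k + 1) m′ → labels m ≡ labels m′ → m ≡ m′)
    × ((a : List ℕ) → IsParkingFunction d k a →
    ∃ λ m → MaxChain d (d * k + 1) m × labels m ≡ a)
-- The argument runs with n = `suc (d * k)`, which is visibly positive, and is transported to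
-- `d * k + 1`.
theorem7p1 d k = subst LabelsBijective (+-comm 1 (d * k)) (chain⇒parking , labels-injective , labels-surjective)
  where
  open Chains d k
  LabelsBijective : ℕ → Set
  LabelsBijective n = ((m : List Partition) → MaxChain d n m → IsParkingFunction d k (labels m))
    × ((m m′ : List Partition) → MaxChain d n m → MaxChain d n m′ → labels m ≡ labels m′ → m ≡ m′)
    × ((a : List ℕ) → IsParkingFunction d k a → ∃ λ m → MaxChain d n m × labels m ≡ a)
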